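{- Let $q$ be a prime power and let $\ell, m, n$ be positive integers with $\max(\ell, n) \leq m$. Let $(\bm{A}, \bm{B}, \bm{C}, \pi)$ be the output of $\mathsf{GenIPKP}(q,\ell,m,n)$, i.e.\ $\bm{A}$ is uniformly random in $\mathbb{F}_q^{\ell \times m, \ell}$, $\bm{B}$ is uniformly random in $\mathbb{F}_q^{m \times n, n}$, $\pi$ is uniformly random in $\mathbb{S}_m$ (all independent), and $\bm{C} = \bm{A}\bm{\pi}\bm{B}$. Then \[ \mathbb{E}\big[N_{\mathsf{sol}}(\bm{A}, \bm{B}, \bm{C})\big] = \sum_{k=1}^m |\mathbb{S}_{m,k}| \sum_{r=0}^{\min(\ell, m - k)} \frac{|\mathbb{F}_q^{\ell \times (m-k), r}| \, |\mathbb{F}_q^{(\ell-r) \times k, \ell - r}| \, q^{k r}}{|\mathbb{F}_q^{\ell \times m, \ell}|} \prod_{i=0}^{n - 1} \frac{q^{m - r} - q^i}{q^m - q^i}. \]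
   Context: $\mathbb{F}_q$ is the finite field with $q$ elements. For integers $a,b,r\ge 0$, $\mathbb{F}_q^{a \times b, r}$ denotes the set of $a\times b$ matrices over $\mathbb{F}_q$ of rank exactly $r$ (with $\mathbb{F}_q^{0\times b,0}$ the one-element set containing the empty matrix). $\mathbb{S}_m$ is the symmetric group on $\{1,\dots,m\}$; for $\pi\in\mathbb{S}_m$, $\bm{\pi}$ is the $m\times m$ permutation matrix whose $(i,j)$ entry is $\delta_{\pi(i),j}$. $\mathbb{S}_{m,k}$ is the set of permutations in $\mathbb{S}_m$ that are a product of exactly $k$ disjoint cycles (counting fixed points as cycles of length 1). For $(\bm{A},\bm{B},\bm{C})\in \mathbb{F}_q^{\ell\times m}\times\mathbb{F}_q^{m\times n}\times\mathbb{F}_q^{\ell\times n}$, $N_{\mathsf{sol}}(\bm{A},\bm{B},\bm{C})$ is the number of $\rho\in\mathbb{S}_m$ with $\bm{A}\bm{\rho}\bm{B}=\bm{C}$. Empty products equal $1$. -}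

module Defs where

open import Level using (Level; _⊔_) renaming (suc to lsuc)
open import Algebra.Bundles using (CommutativeRing)
open import Data.Bool using (Bool; true; false; if_then_else_; _∧_; _∨_; not)
open import Data.Nat as ℕ using (ℕ; zero; suc; _∸_; _≤ᵇ_)
import Data.Nat.Properties as ℕP
open import Data.Fin as Fin using (Fin; toℕ)
import Data.Fin.Properties as FinP
open import Data.List using (List; []; _∷_; [_]; map; concatMap; length; filterᵇ; foldr; allFin; upTo)
open import Data.List.Relation.Unary.Any using (Any)
open import Data.List.Relation.Unary.AllPairs using (AllPairs)
open import Data.Vec.Functional using () renaming (_∷_ to _∷ᶠ_)
open import Data.Product using (∃)
open import Data.Integer as ℤ using (ℤ; +_)
open import Data.Rational as ℚ using (ℚ; 0ℚ; 1ℚ)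
open import Relation.Nullary using (¬_; isYes)
open import Relation.Binary using (Decidable)

record FiniteField (c ℓ : Level) : Set (lsuc (c ⊔ ℓ)) where
  field
    commRing : CommutativeRing c ℓ
  open CommutativeRing commRing public
  field
    _≈?_     : Decidable _≈_
    0≉1      : ¬ (0# ≈ 1#)
    inverse  : ∀ x → ¬ (x ≈ 0#) → ∃ λ y → (x * y) ≈ 1#
    elements : List Carrier
    complete : ∀ x → Any (x ≈_) elements
    distinct : AllPairs (λ x y → ¬ (x ≈ y)) elements

  order : ℕ
  order = length elements

allFuns : ∀ {a} {A : Set a} → List A → (n : ℕ) → List (Fin n → A)
allFuns xs zero    = [ (λ ()) ]
allFuns xs (suc n) = concatMap (λ x → map (λ f → x ∷ᶠ f) (allFuns xs n)) xs

allᵇ : ∀ {a} {A : Set a} → (A → Bool) → List A → Bool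
allᵇ p = foldr (λ x b → p x ∧ b) true

count : ∀ {a} {A : Set a} → (A → Bool) → List A → ℕ
count p xs = length (filterᵇ p xs)

allFinᵇ : (n : ℕ) → (Fin n → Bool) → Bool
allFinᵇ n p = allᵇ p (allFin n)

_==ℕ_ : ℕ → ℕ → Bool
m ==ℕ n = isYes (m ℕ.≟ n)

_==Fin_ : ∀ {n} → Fin n → Fin n → Bool
i ==Fin j = isYes (i Fin.≟ j)

isPerm : ∀ {m} → (Fin m → Fin m) → Bool
isPerm {m} π = allFinᵇ m (λ i → allFinᵇ m (λ j → not (π i ==Fin π j) ∨ (i ==Fin j)))

Sym : (m : ℕ) → List (Fin m → Fin m)
Sym m = filterᵇ isPerm (allFuns (allFin m) m)

iter : ∀ {m} → ℕ → (Fin m → Fin m) → Fin m → Fin m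
iter zero    π i = i
iter (suc t) π i = π (iter t π i)

-- number of disjoint cycles of π (fixed points included): each cycle is
-- counted once, via its least element (i is least in its orbit
-- {π^t(i) : t < m}).
numCycles : ∀ {m} → (Fin m → Fin m) → ℕ
numCycles {m} π =
  count (λ i → allᵇ (λ t → toℕ i ≤ᵇ toℕ (iter t π i)) (upTo m)) (allFin m)

cardSmk : ℕ → ℕ → ℕ
cardSmk m k = count (λ π → numCycles π ==ℕ k) (Sym m)

module _ {c ℓ} (F : FiniteField c ℓ) where
  open FiniteField F

  Mat : ℕ → ℕ → Set c
  Mat a b = Fin a → Fin b → Carrier

  _==F_ : Carrier → Carrier → Bool
  x ==F y = isYes (x ≈? y)

  sumF : ∀ {n} → (Fin n → Carrier) → Carrier
  sumF {n} f = foldr _+_ 0# (map f (allFin n))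

  matMul : ∀ {a b d} → Mat a b → Mat b d → Mat a d
  matMul {b = b} X Y i j = sumF (λ k → X i k * Y k j)

  matEq : ∀ {a b} → Mat a b → Mat a b → Bool
  matEq {a} {b} X Y = allFinᵇ a (λ i → allFinᵇ b (λ j → X i j ==F Y i j))

  permMat : ∀ {m} → (Fin m → Fin m) → Mat m m
  permMat π i j = if π i ==Fin j then 1# else 0#

  allMats : (a b : ℕ) → List (Mat a b)
  allMats a b = allFuns (allFuns elements b) a

  indepRows : ∀ {a b} → Mat a b → (Fin a → Bool) → Bool
  indepRows {a} {b} X S =
    allᵇ (λ γ → not (allFinᵇ a (λ i → S i ∨ (γ i ==F 0#))
                    ∧ allFinᵇ b (λ j → sumF (λ i → γ i * X i j) ==F 0#))
               ∨ allFinᵇ a (λ i → γ i ==F 0#))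
        (allFuns elements a)

  rank : ∀ {a b} → Mat a b → ℕ
  rank {a} X =
    foldr ℕ._⊔_ 0
      (map (λ S → count (λ i → S i) (allFin a))
           (filterᵇ (indepRows X) (allFuns (true ∷ false ∷ []) a)))

  MatsOfRank : (a b r : ℕ) → List (Mat a b)
  MatsOfRank a b r = filterᵇ (λ X → rank X ==ℕ r) (allMats a b)

  cardMatsOfRank : (a b r : ℕ) → ℕ
  cardMatsOfRank a b r = length (MatsOfRank a b r)

  Nsol : ∀ {l m n} → Mat l m → Mat m n → Mat l n → ℕ
  Nsol {m = m} A B C = count (λ ρ → matEq (matMul (matMul A (permMat ρ)) B) C) (Sym m)

-- division of an integer by a natural number; conventionally 0 when the
-- denominator is 0 (never happens where it is used in the theorem).
divℤ : ℤ → ℕ → ℚ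
divℤ z zero    = 0ℚ
divℤ z (suc d) = z ℚ./ suc d

sumℚ : List ℚ → ℚ
sumℚ = foldr ℚ._+_ 0ℚ

prodℚ : List ℚ → ℚ
prodℚ = foldr ℚ._*_ 1ℚ

-- E[N_sol(A,B,C)] for (A,B,C,π) ← GenIPKP(q,l,m,n):
-- A uniform in F^{l×m,l}, B uniform in F^{m×n,n}, π uniform in S_m,
-- independent, and C = AπB.  The expectation of a function of finitely
-- many independent uniform variables is the average over the product.

module _ {c ℓ} (F : FiniteField c ℓ) where
  open FiniteField F using (Carrier)

  expectedNsol : (l m n : ℕ) → ℚ
  expectedNsol l m n =
    divℤ (+ ℕsum)
         (length (MatsOfRank F l m l) ℕ.* length (MatsOfRank F m n n) ℕ.* length (Sym m))
    where
    ℕsum : ℕ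
    ℕsum = foldr ℕ._+_ 0
      (concatMap (λ A → concatMap (λ B → map (λ π →
          Nsol F A B (matMul F (matMul F A (permMat F π)) B))
        (Sym m)) (MatsOfRank F m n n)) (MatsOfRank F l m l))

  formulaRHS : (l m n : ℕ) → ℚ
  formulaRHS l m n =
    sumℚ (map (λ k →
      (+ cardSmk m k ℚ./ 1) ℚ.*
      sumℚ (map (λ r →
          divℤ (+ (cardMatsOfRank F l (m ∸ k) r
                   ℕ.* cardMatsOfRank F (l ∸ r) k (l ∸ r)
                   ℕ.* (q ℕ.^ (k ℕ.* r))))
               (cardMatsOfRank F l m l)
          ℚ.* prodℚ (map (λ i →
                 divℤ (+ (q ℕ.^ (m ∸ r)) ℤ.- + (q ℕ.^ i))
                      (q ℕ.^ m ∸ q ℕ.^ i))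
               (upTo n)))
        (upTo (suc (ℕ._⊓_ l (m ∸ k))))))
      (map suc (upTo m)))
    where
    q : ℕ
    q = FiniteField.order F

{-# OPTIONS --safe #-}

-- Write C = AπB and let the solution be ρ, with π = σρ.  Then AρB = AπB says A M B = 0 for M = ρ − σρ, whose left
-- kernel consists of the vectors constant on the cycles of σ (after relabelling by ρ), so it has q^k elements when σ
-- has k cycles.  Summing over ρ and σ it remains to count, for fixed M, the pairs (A , B) of full rank with A M B = 0.
-- If A M has rank r, the columns of B are independent vectors of a space with q^(m−r) elements, which gives
-- ∏ (q^(m−r) − q^i).  The number of A with rank (A M) = r is found by adding one row at a time: the resulting
-- recursion is also satisfied by the product of the three factors in the formula, so no choice of bases is needed.
-- Ranks are handled through the size of the left kernel, q^(rank X) · |ker X| = q^(number of rows).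
module Submission where

open import Defs
import Algebra.Properties.Ring as RingProperties
import Algebra.Properties.Semiring.Sum as SemiringSum
open import Data.Bool using (Bool; true; false; if_then_else_; T; T?; _∧_; _∨_; not)
open import Data.Bool.Properties using (T-∧; T-∨) renaming (≡-decSetoid to bool-decSetoid)
open import Data.Empty using (⊥-elim)
open import Data.Fin as Fin using (Fin; zero; suc; toℕ)
import Data.Fin.Properties as FinP
import Data.Integer as ℤ
import Data.Integer.Properties as ℤP
open import Data.List using (List; []; _∷_; _++_; map; concatMap; length; filterᵇ; foldr; allFin; tabulate; upTo; applyUpTo)
open import Data.List.Extrema.Nat using (argmin; argmin-sel; f[argmin]≤f[xs])
open import Data.List.Membership.Propositional.Properties using (∈-map⁺; ∈-map⁻; ∈-upTo⁺)
import Data.List.Properties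
open import Data.List.Relation.Unary.All as All using (All; []; _∷_)
open import Data.List.Relation.Unary.AllPairs using (AllPairs; _∷_)
open import Data.List.Relation.Unary.Any as Any using (Any; here; there)
open import Data.Nat using (ℕ; zero; suc; _+_; _*_; _∸_; _^_; _⊔_; _⊓_; _≤_; _<_; _≤ᵇ_; _≤?_; z≤n; s≤s; NonZero; >-nonZero)
import Data.Nat
open import Data.Nat.DivMod using (_/_; _%_; m%n<n; m≡m%n+[m/n]*n)
open import Data.Nat.ListAction using (sum)
open import Data.Nat.Properties hiding (_≟_)
open import Data.Nat.Tactic.RingSolver using (solve-∀)
open import Data.Product using (∃; _×_; _,_; proj₁; proj₂)
open import Data.Rational as ℚ using (ℚ)
import Data.Rational.Properties as ℚP
import Data.Rational.Unnormalised as ℚᵘ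
import Data.Rational.Unnormalised.Properties as ℚᵘP
open import Data.Sum using (_⊎_; inj₁; inj₂)
import Data.Sum
open import Data.Unit using (tt)
open import Data.Vec.Functional using () renaming (_∷_ to _∷ᶠ_)
import Data.Vec.Functional.Relation.Binary.Pointwise.Properties as Pointwise
open import Function using (_∘_; id)
open import Function.Bundles using (module Equivalence; _⇔_; mk⇔)
import Level
open import Level using (Level)
open import Relation.Binary using (DecSetoid)
import Relation.Binary.PropositionalEquality as ≡
open import Relation.Binary.PropositionalEquality using (_≡_; _≗_; cong; cong₂; subst)
import Relation.Binary.Reasoning.Setoid as SetoidReasoning
open import Relation.Nullary using (¬_; Dec; yes; no; does; isYes)
open import Relation.Nullary.Decidable using (_×-dec_; _⊎-dec_; ¬?; map′; toWitness; fromWitness)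
open Equivalence using (to; from)

-- Field elements are compared by `≈`, and vectors, matrices and permutations are functions compared
-- pointwise, so an enumerating list meets each of them once only up to equivalence. Cardinalities
-- are therefore kept as sums of 0/1 indicators over such lists: bijections and double counts become
-- exchanges of summation, at the price of showing that each summand respects the equivalence. A
-- second obstacle is that `rank` is a maximum over independent sets of rows, while A M B = 0
-- constrains the columns of B. Row rank and column rank must be shown equal, and this again is a
-- count, of the pairs (γ , v) with γ X v = 0. The recursion for A rests on one further count: x M
-- lies in the row space of A M for exactly q^(k+r) vectors x. Finally, the number of pairs (A , B)
-- depends on σ through its number of cycles alone, so the sum over ρ yields the factor m!, which
-- cancels the one from the uniform choice of π.

private variable
  ℓ₁ ℓ₂ ℓ₃ ℓ₄ : Level
  A : Set ℓ₁
  B : Set ℓ₂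
  P : Set ℓ₃
  Q : Set ℓ₄

-- Indicators and finite sums of natural numbers

⟦_⟧ : Bool → ℕ
⟦ true ⟧  = 1
⟦ false ⟧ = 0

𝟙 : Dec P → ℕ
𝟙 P? = ⟦ does P? ⟧

𝟙-yes : (P? : Dec P) → P → 𝟙 P? ≡ 1
𝟙-yes (yes _) _ = ≡.refl
𝟙-yes (no ¬x) x = ⊥-elim (¬x x)

𝟙-no : (P? : Dec P) → ¬ P → 𝟙 P? ≡ 0
𝟙-no (yes x) ¬x = ⊥-elim (¬x x)
𝟙-no (no _)  _  = ≡.refl

𝟙-mono : (P? : Dec P) (Q? : Dec Q) → (P → Q) → 𝟙 P? ≤ 𝟙 Q?
𝟙-mono (no _)  Q? f = z≤n
𝟙-mono (yes x) Q? f = ≤-reflexive (≡.sym (𝟙-yes Q? (f x)))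

𝟙-cong : (P? : Dec P) (Q? : Dec Q) → (P → Q) → (Q → P) → 𝟙 P? ≡ 𝟙 Q?
𝟙-cong P? Q? f g = ≤-antisym (𝟙-mono P? Q? f) (𝟙-mono Q? P? g)

𝟙-× : (P? : Dec P) (Q? : Dec Q) → 𝟙 (P? ×-dec Q?) ≡ 𝟙 P? * 𝟙 Q?
𝟙-× (yes _) Q? = ≡.sym (+-identityʳ _)
𝟙-× (no _)  Q? = ≡.refl

-- Where the tested condition fails both sides vanish, so the other factor may be rewritten under
-- that condition.
𝟙-*-cong : (P? : Dec P) {m n : ℕ} → (P → m ≡ n) → 𝟙 P? * m ≡ 𝟙 P? * n
𝟙-*-cong (yes x) f = cong (_+ 0) (f x)
𝟙-*-cong (no _)  f = ≡.refl

∑ : List A → (A → ℕ) → ℕ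
∑ []       f = 0
∑ (x ∷ xs) f = f x + ∑ xs f

∑-cong : ∀ (xs : List A) {f g : A → ℕ} → f ≗ g → ∑ xs f ≡ ∑ xs g
∑-cong []       f≗g = ≡.refl
∑-cong (x ∷ xs) f≗g = cong₂ _+_ (f≗g x) (∑-cong xs f≗g)

∑-mono : ∀ (xs : List A) {f g : A → ℕ} → (∀ x → f x ≤ g x) → ∑ xs f ≤ ∑ xs g
∑-mono []       f≤g = z≤n
∑-mono (x ∷ xs) f≤g = +-mono-≤ (f≤g x) (∑-mono xs f≤g)

∑-+ : ∀ (xs : List A) (f g : A → ℕ) → ∑ xs (λ x → f x + g x) ≡ ∑ xs f + ∑ xs g
∑-+ []       f g = ≡.refl
∑-+ (x ∷ xs) f g rewrite ∑-+ xs f g =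
  interchange (f x) (g x) (∑ xs f) (∑ xs g)
  where
  interchange : ∀ s t u v → s + t + (u + v) ≡ s + u + (t + v)
  interchange = solve-∀

∑-*ˡ : ∀ (xs : List A) n (f : A → ℕ) → ∑ xs (λ x → n * f x) ≡ n * ∑ xs f
∑-*ˡ []       n f = ≡.sym (*-zeroʳ n)
∑-*ˡ (x ∷ xs) n f = ≡.trans (cong (n * f x +_) (∑-*ˡ xs n f)) (≡.sym (*-distribˡ-+ n (f x) _))

∑-*ʳ : ∀ (xs : List A) n (f : A → ℕ) → ∑ xs (λ x → f x * n) ≡ ∑ xs f * n
∑-*ʳ xs n f = ≡.trans (∑-cong xs (λ x → *-comm (f x) n)) (≡.trans (∑-*ˡ xs n f) (*-comm n _))

∑-zero : ∀ (xs : List A) → ∑ xs (λ _ → 0) ≡ 0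
∑-zero []       = ≡.refl
∑-zero (x ∷ xs) = ∑-zero xs

∑-one : ∀ (xs : List A) → ∑ xs (λ _ → 1) ≡ length xs
∑-one []       = ≡.refl
∑-one (x ∷ xs) = cong suc (∑-one xs)

∑-swap : ∀ (xs : List A) (ys : List B) (f : A → B → ℕ) →
  ∑ xs (λ x → ∑ ys (f x)) ≡ ∑ ys (λ y → ∑ xs (λ x → f x y))
∑-swap []       ys f = ≡.sym (∑-zero ys)
∑-swap (x ∷ xs) ys f = ≡.trans (cong (∑ ys (f x) +_) (∑-swap xs ys f)) (≡.sym (∑-+ ys (f x) _))

∑-++ : ∀ (xs ys : List A) f → ∑ (xs ++ ys) f ≡ ∑ xs f + ∑ ys f
∑-++ []       ys f = ≡.refl
∑-++ (x ∷ xs) ys f = ≡.trans (cong (f x +_) (∑-++ xs ys f)) (≡.sym (+-assoc (f x) _ _))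

∑-map : ∀ (g : A → B) xs (f : B → ℕ) → ∑ (map g xs) f ≡ ∑ xs (f ∘ g)
∑-map g []       f = ≡.refl
∑-map g (x ∷ xs) f = cong (f (g x) +_) (∑-map g xs f)

∑-concatMap : ∀ (g : A → List B) xs (f : B → ℕ) → ∑ (concatMap g xs) f ≡ ∑ xs (λ x → ∑ (g x) f)
∑-concatMap g []       f = ≡.refl
∑-concatMap g (x ∷ xs) f = ≡.trans (∑-++ (g x) _ f) (cong (∑ (g x) f +_) (∑-concatMap g xs f))

∑-filter : ∀ (φ : A → Bool) xs f → ∑ (filterᵇ φ xs) f ≡ ∑ xs (λ x → ⟦ φ x ⟧ * f x)
∑-filter φ []       f = ≡.refl
∑-filter φ (x ∷ xs) f with φ x
... | true  = cong₂ _+_ (≡.sym (+-identityʳ (f x))) (∑-filter φ xs f)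
... | false = ∑-filter φ xs f

length-filter : ∀ (φ : A → Bool) xs → length (filterᵇ φ xs) ≡ ∑ xs (⟦_⟧ ∘ φ)
length-filter φ xs = ≡.trans (≡.sym (∑-one (filterᵇ φ xs)))
  (≡.trans (∑-filter φ xs (λ _ → 1)) (∑-cong xs (λ x → *-identityʳ _)))

sum≡∑ : ∀ xs → sum xs ≡ ∑ xs id
sum≡∑ []       = ≡.refl
sum≡∑ (x ∷ xs) = cong (x +_) (sum≡∑ xs)

∑-tabulate : ∀ {n} (g : Fin n → A) (f : A → ℕ) → ∑ (tabulate g) f ≡ ∑ (allFin n) (f ∘ g)
∑-tabulate {n = zero}  g f = ≡.refl
∑-tabulate {n = suc n} g f = cong (f (g zero) +_)
  (≡.trans (∑-tabulate (g ∘ suc) f) (≡.sym (∑-tabulate suc (f ∘ g))))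

∑-allFuns-suc : ∀ (xs : List A) n (f : (Fin (suc n) → A) → ℕ) →
  ∑ (allFuns xs (suc n)) f ≡ ∑ xs (λ x → ∑ (allFuns xs n) (λ g → f (x ∷ᶠ g)))
∑-allFuns-suc xs n f = ≡.trans (∑-concatMap _ xs f) (∑-cong xs (λ x → ∑-map (x ∷ᶠ_) (allFuns xs n) f))

∑-allFuns-one : ∀ (xs : List A) n → ∑ (allFuns xs n) (λ _ → 1) ≡ length xs ^ n
∑-allFuns-one xs zero    = ≡.refl
∑-allFuns-one xs (suc n) = begin
  ∑ (allFuns xs (suc n)) (λ _ → 1)         ≡⟨ ∑-allFuns-suc xs n _ ⟩
  ∑ xs (λ _ → ∑ (allFuns xs n) (λ _ → 1))  ≡⟨ ∑-cong xs (λ _ → ≡.trans (∑-allFuns-one xs n) (≡.sym (*-identityˡ _))) ⟩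
  ∑ xs (λ _ → 1 * length xs ^ n)           ≡⟨ ∑-*ʳ xs _ _ ⟩
  ∑ xs (λ _ → 1) * length xs ^ n           ≡⟨ cong (_* length xs ^ n) (∑-one xs) ⟩
  length xs ^ suc n                        ∎
  where open ≡.≡-Reasoning

isYes≡𝟙 : (P? : Dec P) → ⟦ isYes P? ⟧ ≡ 𝟙 P?
isYes≡𝟙 (yes _) = ≡.refl
isYes≡𝟙 (no _)  = ≡.refl

-- The inclusion of `Q` in `P` makes the truncated subtraction exact: adding the count of `Q` back
-- gives the count of `P`.
count-∖ : ∀ (xs : List A) {P : A → Set ℓ₃} {Q : A → Set ℓ₄} (P? : ∀ x → Dec (P x)) (Q? : ∀ x → Dec (Q x)) →
  (∀ x → Q x → P x) → ∑ xs (λ x → 𝟙 (¬? (Q? x)) * 𝟙 (P? x)) ≡ ∑ xs (λ x → 𝟙 (P? x)) ∸ ∑ xs (λ x → 𝟙 (Q? x))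
count-∖ xs P? Q? Q⊆P = ≡.trans (≡.sym (m+n∸n≡m _ (∑ xs (λ x → 𝟙 (Q? x)))))
  (cong (_∸ ∑ xs (λ x → 𝟙 (Q? x))) (≡.trans (≡.sym (∑-+ xs _ _)) (∑-cong xs split)))
  where
  split : ∀ x → 𝟙 (¬? (Q? x)) * 𝟙 (P? x) + 𝟙 (Q? x) ≡ 𝟙 (P? x)
  split x with Q? x
  ... | yes qx = ≡.sym (𝟙-yes (P? x) (Q⊆P x qx))
  ... | no _   = ≡.trans (+-identityʳ _) (+-identityʳ _)

-- Boolean tests and the propositions they decide

T-isYes : (P? : Dec P) → T (isYes P?) ⇔ P
T-isYes P? = mk⇔ (toWitness {a? = P?}) (fromWitness {a? = P?})

T-allᵇ : ∀ (φ : A → Bool) xs → T (allᵇ φ xs) ⇔ All (T ∘ φ) xs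
T-allᵇ φ []       = mk⇔ (λ _ → []) _
T-allᵇ φ (x ∷ xs) = mk⇔
  (λ t → let u , v = to T-∧ t in u ∷ to (T-allᵇ φ xs) v)
  (λ { (u ∷ v) → from T-∧ (u , from (T-allᵇ φ xs) v) })

All-tabulate : ∀ {n} {R : A → Set ℓ₃} (f : Fin n → A) → All R (tabulate f) ⇔ (∀ i → R (f i))
All-tabulate {n = zero}  f = mk⇔ (λ _ ()) (λ _ → [])
All-tabulate {n = suc n} f = mk⇔
  (λ { (u ∷ v) zero → u ; (u ∷ v) (suc i) → to (All-tabulate (f ∘ suc)) v i })
  (λ g → g zero ∷ from (All-tabulate (f ∘ suc)) (g ∘ suc))

T-allFinᵇ : ∀ n (φ : Fin n → Bool) → T (allFinᵇ n φ) ⇔ (∀ i → T (φ i))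
T-allFinᵇ n φ = mk⇔
  (λ t → to (All-tabulate id) (to (T-allᵇ φ (allFin n)) t))
  (λ g → from (T-allᵇ φ (allFin n)) (from (All-tabulate id) g))

T-not : ∀ {x} → T (not x) ⇔ (¬ T x)
T-not {true}  = mk⇔ (λ ()) (λ f → f _)
T-not {false} = mk⇔ (λ _ ()) _

-- Enumerations up to equivalence and counting by bijections

-- The field `once` says that, up to ≈, every element occurs exactly once in the list.
record Enumeration (a ℓ : Level) : Set (Level.suc (a Level.⊔ ℓ)) where
  field
    decSetoid : DecSetoid a ℓ
  open DecSetoid decSetoid public
  field
    list : List Carrier
    once : ∀ x → ∑ list (λ y → 𝟙 (x ≟ y)) ≡ 1

  -- The surviving term is taken at the listed representative of `x`, not at `x` itself; this is why
  -- `f` must respect `≈`.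
  ∑-δ : ∀ x (f : Carrier → ℕ) → (∀ {y} → x ≈ y → f x ≡ f y) →
    ∑ list (λ y → 𝟙 (x ≟ y) * f y) ≡ f x
  ∑-δ x f f-cong = begin
    ∑ list (λ y → 𝟙 (x ≟ y) * f y)  ≡⟨ ∑-cong list (λ y → 𝟙-*-cong (x ≟ y) (λ e → ≡.sym (f-cong e))) ⟩
    ∑ list (λ y → 𝟙 (x ≟ y) * f x)  ≡⟨ ∑-*ʳ list (f x) _ ⟩
    ∑ list (λ y → 𝟙 (x ≟ y)) * f x  ≡⟨ cong (_* f x) (once x) ⟩
    1 * f x                         ≡⟨ *-identityˡ (f x) ⟩
    f x                             ∎
    where open ≡.≡-Reasoning

  -- An element equivalent to no entry would make the sum in `once` zero.
  member : ∀ x → Any (x ≈_) list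
  member x with Any.any? (x ≟_) list
  ... | yes x∈ = x∈
  ... | no x∉  = ⊥-elim (0≢1+n (≡.trans (≡.sym (absent list x∉)) (once x)))
    where
    absent : ∀ ys → ¬ Any (x ≈_) ys → ∑ ys (λ y → 𝟙 (x ≟ y)) ≡ 0
    absent []       _ = ≡.refl
    absent (y ∷ ys) n = cong₂ _+_ (𝟙-no (x ≟ y) (n ∘ here)) (absent ys (n ∘ there))

  module _ {p} {P : Carrier → Set p} (P? : ∀ x → Dec (P x)) (resp : ∀ {x y} → x ≈ y → P x → P y) where

    ∃? : Dec (∃ P)
    ∃? = map′ Any.satisfied (λ (x , px) → Any.map (λ e → resp e px) (member x)) (Any.any? P? list)

    -- Given one witness, uniqueness bounds the indicator of `P` by that of being equivalent to the
    -- witness, which sums to 1.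
    ∑-≤1 : (∃P? : Dec (∃ P)) → (∀ {x y} → P x → P y → x ≈ y) → ∑ list (λ x → 𝟙 (P? x)) ≤ 𝟙 ∃P?
    ∑-≤1 (yes (x , px)) unique = ≤-trans (∑-mono list (λ y → 𝟙-mono (P? y) (x ≟ y) (unique px))) (≤-reflexive (once x))
    ∑-≤1 (no ∄)         unique = ≤-reflexive (≡.trans (∑-cong list (λ y → 𝟙-no (P? y) (λ py → ∄ (y , py)))) (∑-zero list))

∑[_] : ∀ {a ℓ} (E : Enumeration a ℓ) → (Enumeration.Carrier E → ℕ) → ℕ
∑[ E ] = ∑ (Enumeration.list E)

module _ {a ℓ b ℓ′} (E : Enumeration a ℓ) (E′ : Enumeration b ℓ′) where
  private
    module E = Enumeration E
    module E′ = Enumeration E′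

  -- The factor 1 is inserted as a sum over `y` of the indicator of f x ≈ y; after the exchange of
  -- sums this condition reads g y ≈ x and selects a single `x`.
  ∑-reindex : (f : E.Carrier → E′.Carrier) (g : E′.Carrier → E.Carrier) →
    (∀ {x y} → x E.≈ y → f x E′.≈ f y) → (∀ {x y} → x E′.≈ y → g x E.≈ g y) →
    (∀ x → g (f x) E.≈ x) → (∀ y → f (g y) E′.≈ y) →
    (h : E.Carrier → ℕ) → (∀ {x y} → x E.≈ y → h x ≡ h y) →
    ∑[ E ] h ≡ ∑[ E′ ] (h ∘ g)
  ∑-reindex f g f-cong g-cong gf fg h h-cong = begin
    ∑[ E ] h                                               ≡⟨ ∑-cong E.list (λ x → ≡.trans (≡.sym (*-identityˡ _)) (cong (_* h x) (≡.sym (E′.once (f x))))) ⟩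
    ∑[ E ] (λ x → ∑[ E′ ] (λ y → 𝟙 (f x E′.≟ y)) * h x)    ≡⟨ ∑-cong E.list (λ x → ≡.sym (∑-*ʳ E′.list (h x) _)) ⟩
    ∑[ E ] (λ x → ∑[ E′ ] (λ y → 𝟙 (f x E′.≟ y) * h x))    ≡⟨ ∑-swap E.list E′.list _ ⟩
    ∑[ E′ ] (λ y → ∑[ E ] (λ x → 𝟙 (f x E′.≟ y) * h x))    ≡⟨ ∑-cong E′.list (λ y → ∑-cong E.list (λ x → cong (_* h x)
                                                               (𝟙-cong (f x E′.≟ y) (g y E.≟ x)
                                                                 (λ e → E.trans (g-cong (E′.sym e)) (gf x))
                                                                 (λ e → E′.trans (f-cong (E.sym e)) (fg y))))) ⟩
    ∑[ E′ ] (λ y → ∑[ E ] (λ x → 𝟙 (g y E.≟ x) * h x))     ≡⟨ ∑-cong E′.list (λ y → E.∑-δ (g y) h h-cong) ⟩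
    ∑[ E′ ] (h ∘ g)                                        ∎
    where open ≡.≡-Reasoning

  -- Here `f` and `g` are total but mutually inverse only on `P` and `Q`. The graph of `f` over `P`
  -- is the transposed graph of `g` over `Q`, and it is summed in both orders.
  count-bijection : ∀ {p r} {P : E.Carrier → Set p} {Q : E′.Carrier → Set r}
    (P? : ∀ x → Dec (P x)) (Q? : ∀ y → Dec (Q y)) →
    (∀ {x y} → x E.≈ y → P x → P y) → (∀ {x y} → x E′.≈ y → Q x → Q y) →
    (f : E.Carrier → E′.Carrier) (g : E′.Carrier → E.Carrier) →
    (∀ {x y} → x E.≈ y → f x E′.≈ f y) → (∀ {x y} → x E′.≈ y → g x E.≈ g y) →
    (∀ {x} → P x → Q (f x)) → (∀ {y} → Q y → P (g y)) →
    (∀ {x} → P x → g (f x) E.≈ x) → (∀ {y} → Q y → f (g y) E′.≈ y) →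
    ∑[ E ] (λ x → 𝟙 (P? x)) ≡ ∑[ E′ ] (λ y → 𝟙 (Q? y))
  count-bijection P? Q? P-resp Q-resp f g f-cong g-cong PQ QP gf fg = begin
    ∑[ E ] (λ x → 𝟙 (P? x))                                        ≡⟨ ∑-cong E.list (λ x → ≡.trans (≡.sym (*-identityʳ _)) (cong (𝟙 (P? x) *_) (≡.sym (E′.once (f x))))) ⟩
    ∑[ E ] (λ x → 𝟙 (P? x) * ∑[ E′ ] (λ y → 𝟙 (f x E′.≟ y)))       ≡⟨ ∑-cong E.list (λ x → ≡.sym (∑-*ˡ E′.list (𝟙 (P? x)) _)) ⟩
    ∑[ E ] (λ x → ∑[ E′ ] (λ y → 𝟙 (P? x) * 𝟙 (f x E′.≟ y)))       ≡⟨ ∑-swap E.list E′.list _ ⟩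
    ∑[ E′ ] (λ y → ∑[ E ] (λ x → 𝟙 (P? x) * 𝟙 (f x E′.≟ y)))       ≡⟨ ∑-cong E′.list (λ y → ∑-cong E.list (λ x → graph x y)) ⟩
    ∑[ E′ ] (λ y → ∑[ E ] (λ x → 𝟙 (Q? y) * 𝟙 (g y E.≟ x)))        ≡⟨ ∑-cong E′.list (λ y → ∑-*ˡ E.list (𝟙 (Q? y)) _) ⟩
    ∑[ E′ ] (λ y → 𝟙 (Q? y) * ∑[ E ] (λ x → 𝟙 (g y E.≟ x)))        ≡⟨ ∑-cong E′.list (λ y → ≡.trans (cong (𝟙 (Q? y) *_) (E.once (g y))) (*-identityʳ _)) ⟩
    ∑[ E′ ] (λ y → 𝟙 (Q? y))                                       ∎
    where
    open ≡.≡-Reasoning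
    graph : ∀ x y → 𝟙 (P? x) * 𝟙 (f x E′.≟ y) ≡ 𝟙 (Q? y) * 𝟙 (g y E.≟ x)
    graph x y = ≡.trans (≡.sym (𝟙-× (P? x) (f x E′.≟ y))) (≡.trans
      (𝟙-cong (P? x ×-dec (f x E′.≟ y)) (Q? y ×-dec (g y E.≟ x))
        (λ (px , e) → Q-resp e (PQ px) , E.trans (g-cong (E′.sym e)) (gf px))
        (λ (qy , e) → P-resp e (QP qy) , E′.trans (f-cong (E.sym e)) (fg qy)))
      (𝟙-× (Q? y) (g y E.≟ x)))

functions : ∀ {a ℓ} → Enumeration a ℓ → ℕ → Enumeration a ℓ
functions E n = record
  { decSetoid = Pointwise.decSetoid decSetoid n
  ; list      = allFuns list n
  ; once      = functions-once n
  }
  where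
  open Enumeration E
  functions-once : ∀ n (f : Fin n → Carrier) →
    ∑ (allFuns list n) (λ g → 𝟙 (DecSetoid._≟_ (Pointwise.decSetoid decSetoid n) f g)) ≡ 1
  functions-once zero    f = ≡.refl
  functions-once (suc n) f = begin
    ∑ (allFuns list (suc n)) (λ g → 𝟙 (f ≟ₛ g))                              ≡⟨ ∑-allFuns-suc list n _ ⟩
    ∑ list (λ x → ∑ (allFuns list n) (λ g → 𝟙 (f ≟ₛ (x ∷ᶠ g))))              ≡⟨ ∑-cong list (λ x → ∑-cong (allFuns list n) (λ g → split x g)) ⟩
    ∑ list (λ x → ∑ (allFuns list n) (λ g → 𝟙 (f zero ≟ x) * 𝟙 ((f ∘ suc) ≟ₙ g))) ≡⟨ ∑-cong list (λ x → ∑-*ˡ (allFuns list n) (𝟙 (f zero ≟ x)) _) ⟩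
    ∑ list (λ x → 𝟙 (f zero ≟ x) * ∑ (allFuns list n) (λ g → 𝟙 ((f ∘ suc) ≟ₙ g))) ≡⟨ ∑-cong list (λ x → ≡.trans (cong (𝟙 (f zero ≟ x) *_) (functions-once n (f ∘ suc))) (*-identityʳ _)) ⟩
    ∑ list (λ x → 𝟙 (f zero ≟ x))                                            ≡⟨ once (f zero) ⟩
    1                                                                        ∎
    where
    open ≡.≡-Reasoning
    open DecSetoid (Pointwise.decSetoid decSetoid (suc n)) using () renaming (_≟_ to _≟ₛ_)
    open DecSetoid (Pointwise.decSetoid decSetoid n) using () renaming (_≟_ to _≟ₙ_)
    split : ∀ x g → 𝟙 (f ≟ₛ (x ∷ᶠ g)) ≡ 𝟙 (f zero ≟ x) * 𝟙 ((f ∘ suc) ≟ₙ g)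
    split x g = ≡.trans
      (𝟙-cong (f ≟ₛ (x ∷ᶠ g)) ((f zero ≟ x) ×-dec ((f ∘ suc) ≟ₙ g))
        (λ h → h zero , h ∘ suc)
        (λ { (h , t) zero → h ; (h , t) (suc i) → t i }))
      (𝟙-× (f zero ≟ x) ((f ∘ suc) ≟ₙ g))

fin : ℕ → Enumeration _ _
fin n = record
  { decSetoid = FinP.≡-decSetoid n
  ; list      = allFin n
  ; once      = fin-once
  }
  where
  fin-once : ∀ {n} (i : Fin n) → ∑ (allFin n) (λ j → 𝟙 (i Fin.≟ j)) ≡ 1
  fin-once {suc n} zero    = cong suc (≡.trans (∑-tabulate suc (λ j → 𝟙 (zero {n} Fin.≟ j))) (∑-zero (allFin n)))
  fin-once {suc n} (suc i) = ≡.trans (∑-tabulate suc (λ j → 𝟙 (suc i Fin.≟ j)))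
    (≡.trans (∑-cong (allFin n) (λ j → 𝟙-cong (suc i Fin.≟ suc j) (i Fin.≟ j) FinP.suc-injective (cong suc))) (fin-once i))

-- Vectors, row combinations, left kernels and row spaces over a finite field

module LinearAlgebra {c ℓ} (F : FiniteField c ℓ) where
  private module F = FiniteField F
  open RingProperties F.ring using (-‿distribˡ-*; -0#≈0#; -‿involutive; //-rightDividesˡ; //-rightDividesʳ)
  open F using (Carrier; _≈_; 0#; 1#; elements) renaming (_+_ to _⊕_; _*_ to _⊗_; -_ to ⊖_)
  open SemiringSum F.semiring using (sum-cong-≋; ∑-distrib-+; ∑-comm; *-distribˡ-sum) renaming (sum to S)

  q : ℕ
  q = F.order

  𝔽 : Enumeration c ℓ
  𝔽 = record
    { decSetoid = record { isDecEquivalence = record { isEquivalence = F.isEquivalence ; _≟_ = F._≈?_ } }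
    ; list      = elements
    ; once      = λ x → once-in x elements F.distinct (F.complete x)
    }
    where
    none-in : ∀ {x y} ys → x ≈ y → All (λ z → ¬ (y ≈ z)) ys → ∑ ys (λ z → 𝟙 (x F.≈? z)) ≡ 0
    none-in []       _ []         = ≡.refl
    none-in (z ∷ zs) e (y≉z ∷ ps) = cong₂ _+_ (𝟙-no (_ F.≈? z) (λ x≈z → y≉z (F.trans (F.sym e) x≈z))) (none-in zs e ps)
    once-in : ∀ x ys → AllPairs (λ y z → ¬ (y ≈ z)) ys → Any (x ≈_) ys → ∑ ys (λ z → 𝟙 (x F.≈? z)) ≡ 1
    once-in x (y ∷ ys) (y≉ ∷ _) (here e)   = cong₂ _+_ (𝟙-yes (x F.≈? y) e) (none-in ys e y≉)
    once-in x (y ∷ ys) (y≉ ∷ d) (there x∈) = cong₂ _+_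
      (𝟙-no (x F.≈? y) (λ e → let y≉z , x≈z = All.lookupAny y≉ x∈ in y≉z (F.trans (F.sym e) x≈z)))
      (once-in x ys d x∈)

  -- As 0 and 1 differ, no list entry is equivalent to both, while their indicators together sum to
  -- 2.
  1<q : 1 < q
  1<q = ≤-trans (≤-reflexive (≡.sym both)) (≤-trans (∑-mono elements exclusive) (≤-reflexive (∑-one elements)))
    where
    both : ∑ elements (λ x → 𝟙 (0# F.≈? x) + 𝟙 (1# F.≈? x)) ≡ 2
    both = ≡.trans (∑-+ elements _ _) (cong₂ _+_ (Enumeration.once 𝔽 0#) (Enumeration.once 𝔽 1#))
    exclusive : ∀ x → 𝟙 (0# F.≈? x) + 𝟙 (1# F.≈? x) ≤ 1
    exclusive x with 0# F.≈? x | 1# F.≈? x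
    ... | yes e | yes e′ = ⊥-elim (F.0≉1 (F.trans e (F.sym e′)))
    ... | yes _ | no _   = ≤-refl
    ... | no _  | yes _  = ≤-refl
    ... | no _  | no _   = z≤n

  V : ℕ → Enumeration c ℓ
  V = functions 𝔽

  Vec : ℕ → Set c
  Vec n = Fin n → Carrier

  module V {n} = Enumeration (V n)
  open V using () renaming (_≈_ to _≋_; _≟_ to _≋?_)

  infixl 6 _⊞_ _⊟_
  infixl 7 _⊙_ _·_
  infix 4 _∈row_ _∈row?_

  0v : ∀ {n} → Vec n
  0v _ = 0#

  _⊞_ _⊟_ : ∀ {n} → Vec n → Vec n → Vec n
  (u ⊞ v) i = u i ⊕ v i
  (u ⊟ v) i = u i ⊕ ⊖ v i

  _⊙_ : ∀ {n} → Carrier → Vec n → Vec n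
  (x ⊙ v) i = x ⊗ v i

  _·_ : ∀ {a b} → Vec a → Mat F a b → Vec b
  (γ · X) j = sumF F (λ i → γ i ⊗ X i j)

  x+y-y : ∀ x y → (x ⊕ y) ⊕ ⊖ y ≈ x
  x+y-y x y = //-rightDividesʳ y x

  x-y+y : ∀ x y → (x ⊕ ⊖ y) ⊕ y ≈ x
  x-y+y x y = //-rightDividesˡ y x

  +≈⇒≈- : ∀ {x y z} → x ⊕ y ≈ z → x ≈ z ⊕ ⊖ y
  +≈⇒≈- {x} {y} e = F.trans (F.sym (x+y-y x y)) (F.+-congʳ e)

  -≈0⇒≈ : ∀ {x y} → x ⊕ ⊖ y ≈ 0# → x ≈ y
  -≈0⇒≈ {x} {y} e = F.trans (F.sym (x-y+y x y)) (F.trans (F.+-congʳ e) (F.+-identityˡ y))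

  ≈⇒-≈0 : ∀ {x y} → x ≈ y → x ⊕ ⊖ y ≈ 0#
  ≈⇒-≈0 {x} {y} e = F.trans (F.+-congʳ e) (F.-‿inverseʳ y)

  sumF≡S : ∀ {n} (f : Vec n) → sumF F f ≡ S f
  sumF≡S f = along id
    where
    -- `allFin` is `tabulate id`; replacing `id` by an arbitrary `g` makes the induction go through.
    along : ∀ {k} (g : Fin k → _) → foldr _⊕_ 0# (map f (tabulate g)) ≡ S (f ∘ g)
    along {zero}  g = ≡.refl
    along {suc k} g = cong (f (g zero) ⊕_) (along (g ∘ suc))

  sumF≈S : ∀ {n} (f : Vec n) → sumF F f ≈ S f
  sumF≈S f = F.reflexive (sumF≡S f)

  sumF-cong : ∀ n {f g : Vec n} → f ≋ g → sumF F f ≈ sumF F g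
  sumF-cong n {f} {g} e = F.trans (sumF≈S f) (F.trans (sum-cong-≋ e) (F.sym (sumF≈S g)))

  sumF-⊕ : ∀ {n} (f g : Vec n) → sumF F (f ⊞ g) ≈ sumF F f ⊕ sumF F g
  sumF-⊕ f g = F.trans (sumF≈S (f ⊞ g)) (F.trans (∑-distrib-+ f g) (F.sym (F.+-cong (sumF≈S f) (sumF≈S g))))

  sumF-⊗ˡ : ∀ {n} x (f : Vec n) → sumF F (x ⊙ f) ≈ x ⊗ sumF F f
  sumF-⊗ˡ x f = F.trans (sumF≈S (x ⊙ f)) (F.trans (F.sym (*-distribˡ-sum x f)) (F.*-congˡ (F.sym (sumF≈S f))))

  sumF-⊗ʳ : ∀ {n} x (f : Vec n) → sumF F (λ i → f i ⊗ x) ≈ sumF F f ⊗ x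
  sumF-⊗ʳ {n} x f = F.trans (sumF-cong n (λ i → F.*-comm (f i) x)) (F.trans (sumF-⊗ˡ x f) (F.*-comm x _))

  sumF-swap : ∀ {m n} (f : Fin m → Fin n → Carrier) →
    sumF F (λ i → sumF F (f i)) ≈ sumF F (λ j → sumF F (λ i → f i j))
  sumF-swap f = F.trans (outer f) (F.trans (∑-comm f) (F.sym (outer (λ j i → f i j))))
    where
    outer : ∀ {m n} (f : Fin m → Fin n → Carrier) → sumF F (λ i → sumF F (f i)) ≈ S (λ i → S (f i))
    outer {m} f = F.trans (sumF≈S (λ i → sumF F (f i))) (sum-cong-≋ (λ i → sumF≈S (f i)))

  sumF-suc : ∀ {n} (f : Vec (suc n)) → sumF F f ≈ f zero ⊕ sumF F (f ∘ suc)
  sumF-suc f = F.trans (sumF≈S f) (F.+-congˡ (F.sym (sumF≈S (f ∘ suc))))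

  sumF-zero : ∀ n {f : Vec n} → f ≋ 0v → sumF F f ≈ 0#
  sumF-zero n {f} e = begin
    -- Each zero entry is written as 0 ⊗ 0, so that the scalar 0 can be drawn out of the sum.
    sumF F f                    ≈⟨ sumF-cong n (λ i → F.trans (e i) (F.sym (F.zeroˡ 0#))) ⟩
    sumF F (0# ⊙ 0v {n})        ≈⟨ sumF-⊗ˡ 0# (0v {n}) ⟩
    0# ⊗ sumF F (0v {n})        ≈⟨ F.zeroˡ _ ⟩
    0#                          ∎
    where open SetoidReasoning F.setoid

  ·-cong : ∀ {a b} {γ δ : Vec a} {X Y : Mat F a b} → γ ≋ δ → (∀ i → X i ≋ Y i) → γ · X ≋ δ · Y
  ·-cong {a} e E j = sumF-cong a (λ i → F.*-cong (e i) (E i j))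

  ·-congˡ : ∀ {a b} {γ δ : Vec a} (X : Mat F a b) → γ ≋ δ → γ · X ≋ δ · X
  ·-congˡ X e = ·-cong {X = X} {X} e (λ i j → F.refl)

  ·-⊞ : ∀ {a b} (γ δ : Vec a) (X : Mat F a b) → (γ ⊞ δ) · X ≋ γ · X ⊞ δ · X
  ·-⊞ {a} γ δ X j = F.trans (sumF-cong a (λ i → F.distribʳ (X i j) (γ i) (δ i))) (sumF-⊕ (λ i → γ i ⊗ X i j) (λ i → δ i ⊗ X i j))

  ·-⊙ : ∀ {a b} x (γ : Vec a) (X : Mat F a b) → (x ⊙ γ) · X ≋ x ⊙ (γ · X)
  ·-⊙ {a} x γ X j = F.trans (sumF-cong a (λ i → F.*-assoc x (γ i) (X i j))) (sumF-⊗ˡ x (λ i → γ i ⊗ X i j))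

  ·-⊟ : ∀ {a b} (γ δ : Vec a) (X : Mat F a b) → (γ ⊟ δ) · X ≋ γ · X ⊟ δ · X
  ·-⊟ γ δ X j = +≈⇒≈- (F.trans (F.sym (·-⊞ (γ ⊟ δ) δ X j)) (·-congˡ X (λ i → x-y+y (γ i) (δ i)) j))

  ·-0v : ∀ {a b} (X : Mat F a b) → 0v · X ≋ 0v
  ·-0v {a} X j = sumF-zero a (λ i → F.zeroˡ (X i j))

  ·-suc : ∀ {a b} (γ : Vec (suc a)) (X : Mat F (suc a) b) →
    γ · X ≋ (γ zero ⊙ X zero) ⊞ (γ ∘ suc) · (X ∘ suc)
  ·-suc γ X j = sumF-suc (λ i → γ i ⊗ X i j)

  ·-assoc : ∀ {a b d} (γ : Vec a) (X : Mat F a b) (Y : Mat F b d) → (γ · X) · Y ≋ γ · matMul F X Y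
  ·-assoc {a} {b} γ X Y j = begin
    sumF F (λ k → sumF F (λ i → γ i ⊗ X i k) ⊗ Y k j)     ≈⟨ sumF-cong b (λ k → F.sym (sumF-⊗ʳ (Y k j) (λ i → γ i ⊗ X i k))) ⟩
    sumF F (λ k → sumF F (λ i → γ i ⊗ X i k ⊗ Y k j))     ≈⟨ sumF-swap (λ k i → γ i ⊗ X i k ⊗ Y k j) ⟩
    sumF F (λ i → sumF F (λ k → γ i ⊗ X i k ⊗ Y k j))     ≈⟨ sumF-cong a (λ i → F.trans (sumF-cong b (λ k → F.*-assoc (γ i) (X i k) (Y k j))) (sumF-⊗ˡ (γ i) (λ k → X i k ⊗ Y k j))) ⟩
    sumF F (λ i → γ i ⊗ sumF F (λ k → X i k ⊗ Y k j))     ∎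
    where open SetoidReasoning F.setoid

  open ≡.≡-Reasoning

  ker : ∀ {a b} → Mat F a b → ℕ
  ker {a} X = ∑[ V a ] (λ γ → 𝟙 (γ · X ≋? 0v))

  _∈row_ : ∀ {a b} → Vec b → Mat F a b → Set _
  x ∈row X = ∃ λ γ → γ · X ≋ x

  _∈row?_ : ∀ {a b} (x : Vec b) (X : Mat F a b) → Dec (x ∈row X)
  _∈row?_ {a} x X = V.∃? {a} (λ γ → γ · X ≋? x) (λ e e′ → V.trans (·-congˡ X (V.sym e)) e′)

  ∈row-resp : ∀ {a b} (X : Mat F a b) {x y} → x ≋ y → x ∈row X → y ∈row X
  ∈row-resp X e (γ , e′) = γ , V.trans e′ e

  rowSize : ∀ {a b} → Mat F a b → ℕ
  rowSize {b = b} X = ∑[ V b ] (λ x → 𝟙 (x ∈row? X))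

  |V| : ∀ n → ∑[ V n ] (λ _ → 1) ≡ q ^ n
  |V| n = ∑-allFuns-one elements n

  -- A nonempty fibre is a coset of the left kernel: translation by one preimage `γ₀` carries one to
  -- the other. The decision is an argument, so that a case split on it also evaluates the indicator
  -- on the right.
  fibre : ∀ {a b} (X : Mat F a b) (x : Vec b) (x∈? : Dec (x ∈row X)) →
    ∑[ V a ] (λ γ → 𝟙 (γ · X ≋? x)) ≡ 𝟙 x∈? * ker X
  fibre {a} X x (no x∉)        = ≡.trans (∑-cong (V.list {a}) (λ γ → 𝟙-no (γ · X ≋? x) (λ e → x∉ (γ , e)))) (∑-zero (V.list {a}))
  fibre {a} X x (yes (γ₀ , e)) = ≡.trans
    (∑-reindex (V a) (V a) (_⊟ γ₀) (_⊞ γ₀)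
      (λ e i → F.+-congʳ (e i)) (λ e i → F.+-congʳ (e i))
      (λ γ i → x-y+y (γ i) (γ₀ i)) (λ γ i → x+y-y (γ i) (γ₀ i))
      (λ γ → 𝟙 (γ · X ≋? x))
      (λ {γ} {δ} γ≋δ → 𝟙-cong (γ · X ≋? x) (δ · X ≋? x) (V.trans (·-congˡ X (V.sym γ≋δ))) (V.trans (·-congˡ X γ≋δ))))
    (≡.trans (∑-cong (V.list {a}) shift) (≡.sym (+-identityʳ (ker X))))
    where
    shift : ∀ γ → 𝟙 ((γ ⊞ γ₀) · X ≋? x) ≡ 𝟙 (γ · X ≋? 0v)
    shift γ = 𝟙-cong ((γ ⊞ γ₀) · X ≋? x) (γ · X ≋? 0v)
      (λ e′ j → F.trans (+≈⇒≈- (F.trans (F.sym (·-⊞ γ γ₀ X j)) (e′ j))) (≈⇒-≈0 (F.sym (e j))))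
      (λ e′ j → F.trans (·-⊞ γ γ₀ X j) (F.trans (F.+-cong (e′ j) (e j)) (F.+-identityˡ (x j))))

  -- The vectors γ are grouped by the value γ · X; each value in the row space is taken `ker X`
  -- times.
  fibre-sum : ∀ {a b} (X : Mat F a b) (f : Vec b → ℕ) → (∀ {x y} → x ≋ y → f x ≡ f y) →
    ∑[ V a ] (λ γ → f (γ · X)) ≡ ker X * ∑[ V b ] (λ x → 𝟙 (x ∈row? X) * f x)
  fibre-sum {a} {b} X f f-cong = begin
    ∑[ V a ] (λ γ → f (γ · X))                                     ≡⟨ ∑-cong (V.list {a}) (λ γ → ≡.sym (V.∑-δ (γ · X) f f-cong)) ⟩
    ∑[ V a ] (λ γ → ∑[ V b ] (λ x → 𝟙 (γ · X ≋? x) * f x))         ≡⟨ ∑-swap (V.list {a}) (V.list {b}) _ ⟩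
    ∑[ V b ] (λ x → ∑[ V a ] (λ γ → 𝟙 (γ · X ≋? x) * f x))         ≡⟨ ∑-cong (V.list {b}) (λ x → ∑-*ʳ (V.list {a}) (f x) _) ⟩
    ∑[ V b ] (λ x → ∑[ V a ] (λ γ → 𝟙 (γ · X ≋? x)) * f x)         ≡⟨ ∑-cong (V.list {b}) (λ x → cong (_* f x) (≡.trans (fibre X x (x ∈row? X)) (*-comm _ (ker X)))) ⟩
    ∑[ V b ] (λ x → ker X * 𝟙 (x ∈row? X) * f x)                   ≡⟨ ∑-cong (V.list {b}) (λ x → *-assoc (ker X) _ _) ⟩
    ∑[ V b ] (λ x → ker X * (𝟙 (x ∈row? X) * f x))                 ≡⟨ ∑-*ˡ (V.list {b}) (ker X) _ ⟩
    ker X * ∑[ V b ] (λ x → 𝟙 (x ∈row? X) * f x)                   ∎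

  -- Rank and nullity in counting form: the case f = 1 of `fibre-sum`.
  ker*rowSize : ∀ {a b} (X : Mat F a b) → ker X * rowSize X ≡ q ^ a
  ker*rowSize {a} {b} X = ≡.trans
    (cong (ker X *_) (∑-cong (V.list {b}) (λ x → ≡.sym (*-identityʳ _))))
    (≡.trans (≡.sym (fibre-sum X (λ _ → 1) (λ _ → ≡.refl))) (|V| a))

  ∈row-⊙ : ∀ {a b} (X : Mat F a b) {x} y → x ∈row X → y ⊙ x ∈row X
  ∈row-⊙ X y (γ , e) = y ⊙ γ , V.trans (·-⊙ y γ X) (λ j → F.*-congˡ (e j))

  ∈row-unscale : ∀ {a b} (X : Mat F a b) {x y} → ¬ (y ≈ 0#) → y ⊙ x ∈row X → x ∈row X
  ∈row-unscale X {x} {y} y≉0 yx∈ = ∈row-resp X unscale (∈row-⊙ X (proj₁ inv) yx∈)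
    where
    inv = F.inverse y y≉0
    unscale : proj₁ inv ⊙ (y ⊙ x) ≋ x
    unscale j = F.trans (F.sym (F.*-assoc _ _ _)) (F.trans (F.*-congʳ (F.trans (F.*-comm _ _) (proj₂ inv))) (F.*-identityˡ (x j)))

  -≈0⇒≈0 : ∀ {y} → ⊖ y ≈ 0# → y ≈ 0#
  -≈0⇒≈0 {y} e = F.trans (F.sym (-‿involutive y)) (F.trans (F.-‿cong e) -0#≈0#)

  solve-head : ∀ {a b} (X : Mat F (suc a) b) (γ : Vec (suc a)) →
    γ · X ≋ 0v → (γ ∘ suc) · (X ∘ suc) ≋ (⊖ γ zero) ⊙ X zero
  solve-head X γ e j = F.trans
    (+≈⇒≈- (F.trans (F.+-comm _ _) (F.trans (F.sym (·-suc γ X j)) (e j))))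
    (F.trans (F.+-identityˡ _) (-‿distribˡ-* (γ zero) (X zero j)))

  unsolve-head : ∀ {a b} (X : Mat F (suc a) b) (γ : Vec (suc a)) →
    (γ ∘ suc) · (X ∘ suc) ≋ (⊖ γ zero) ⊙ X zero → γ · X ≋ 0v
  unsolve-head X γ e j = F.trans (·-suc γ X j)
    (F.trans (F.+-congˡ (F.trans (e j) (F.sym (-‿distribˡ-* (γ zero) (X zero j))))) (F.-‿inverseʳ _))

  -- For a leading coefficient y, the remaining coefficients must represent -y times the first row
  -- by the other rows. If the first row lies in their span this is possible for all q values of y,
  -- otherwise only for y = 0; each possible y contributes a coset of the smaller kernel.
  ker-suc : ∀ {a b} (X : Mat F (suc a) b) (x∈? : Dec (X zero ∈row (X ∘ suc))) →
    ker X ≡ (𝟙 x∈? * q + 𝟙 (¬? x∈?)) * ker (X ∘ suc)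
  ker-suc {a} X x∈? = begin
    ker X                                                       ≡⟨ ∑-allFuns-suc elements a _ ⟩
    ∑[ 𝔽 ] (λ y → ∑[ V a ] (λ γ → 𝟙 ((y ∷ᶠ γ) · X ≋? 0v)))      ≡⟨ ∑-cong elements (λ y → ∑-cong (V.list {a}) (λ γ →
                                                                     𝟙-cong ((y ∷ᶠ γ) · X ≋? 0v) (γ · X′ ≋? (⊖ y) ⊙ x) (solve-head X (y ∷ᶠ γ)) (unsolve-head X (y ∷ᶠ γ)))) ⟩
    ∑[ 𝔽 ] (λ y → ∑[ V a ] (λ γ → 𝟙 (γ · X′ ≋? (⊖ y) ⊙ x)))     ≡⟨ ∑-cong elements (λ y → fibre X′ _ ((⊖ y) ⊙ x ∈row? X′)) ⟩
    ∑[ 𝔽 ] (λ y → 𝟙 ((⊖ y) ⊙ x ∈row? X′) * ker X′)              ≡⟨ ∑-*ʳ elements (ker X′) _ ⟩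
    ∑[ 𝔽 ] (λ y → 𝟙 ((⊖ y) ⊙ x ∈row? X′)) * ker X′              ≡⟨ cong (_* ker X′) (multiples x∈?) ⟩
    (𝟙 x∈? * q + 𝟙 (¬? x∈?)) * ker X′                           ∎
    where
    x  = X zero
    X′ = X ∘ suc
    multiples : (d : Dec (x ∈row X′)) → ∑[ 𝔽 ] (λ y → 𝟙 ((⊖ y) ⊙ x ∈row? X′)) ≡ 𝟙 d * q + 𝟙 (¬? d)
    multiples (yes x∈) = ≡.trans (∑-cong elements (λ y → 𝟙-yes ((⊖ y) ⊙ x ∈row? X′) (∈row-⊙ X′ _ x∈)))
      (≡.trans (∑-one elements) (≡.sym (≡.trans (+-identityʳ _) (*-identityˡ q))))
    multiples (no x∉)  = ≡.trans (∑-cong elements (λ y → 𝟙-cong ((⊖ y) ⊙ x ∈row? X′) (0# F.≈? y) (only-0 y) (at-0 y)))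
      (Enumeration.once 𝔽 0#)
      where
      at-0 : ∀ y → 0# ≈ y → (⊖ y) ⊙ x ∈row X′
      at-0 y e = 0v , (λ j → F.trans (·-0v X′ j) (F.sym (F.trans (F.*-congʳ (F.trans (F.-‿cong (F.sym e)) -0#≈0#)) (F.zeroˡ (x j)))))
      only-0 : ∀ y → (⊖ y) ⊙ x ∈row X′ → 0# ≈ y
      only-0 y yx∈ with 0# F.≈? y
      ... | yes e  = e
      ... | no 0≉y = ⊥-elim (x∉ (∈row-unscale X′ (λ e → 0≉y (F.sym (-≈0⇒≈0 e))) yx∈))

-- Rank as the exponent in the size of kernel and row space

module Rank {c ℓ} (F : FiniteField c ℓ) where
  private module F = FiniteField F
  open F using (_≈_; 0#; elements)
  open LinearAlgebra F
  open V using () renaming (_≈_ to _≋_; _≟_ to _≋?_)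
  open ≡.≡-Reasoning

  instance
    q≢0 : NonZero q
    q≢0 = >-nonZero (≤-trans (s≤s z≤n) 1<q)

    q^≢0 : ∀ {n} → NonZero (q ^ n)
    q^≢0 {n} = m^n≢0 q n

  ker≢0 : ∀ {a b} (X : Mat F a b) → NonZero (ker X)
  ker≢0 {a} X = m*n≢0⇒m≢0 (ker X) {{subst NonZero (≡.sym (ker*rowSize X)) (q^≢0 {a})}}

  q^-cancel-≤ : ∀ {m n} → q ^ m ≤ q ^ n → m ≤ n
  q^-cancel-≤ {m} {n} le with m ≤? n
  ... | yes m≤n = m≤n
  ... | no m≰n  = ⊥-elim (<⇒≱ (^-monoʳ-< q 1<q (≰⇒> m≰n)) le)

  q^-injective : ∀ {m n} → q ^ m ≡ q ^ n → m ≡ n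
  q^-injective e = ≤-antisym (q^-cancel-≤ (≤-reflexive e)) (q^-cancel-≤ (≤-reflexive (≡.sym e)))

  card : ∀ {a} → (Fin a → Bool) → ℕ
  card {a} S = count (λ i → S i) (allFin a)

  card≡∑ : ∀ {a} (S : Fin a → Bool) → card S ≡ ∑ (allFin a) (λ i → ⟦ S i ⟧)
  card≡∑ {a} S = length-filter S (allFin a)

  card-suc : ∀ {a} (S : Fin (suc a) → Bool) → card S ≡ ⟦ S zero ⟧ + card (S ∘ suc)
  card-suc {a} S = ≡.trans (card≡∑ S) (cong (⟦ S zero ⟧ +_) (≡.trans (∑-tabulate {n = a} Fin.suc (λ i → ⟦ S i ⟧)) (≡.sym (card≡∑ (S ∘ suc)))))

  -- Coefficients for the rows in `S` are kept as full-length vectors vanishing elsewhere, which is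
  -- how `indepRows` quantifies over them.
  Supported : ∀ {a} → (Fin a → Bool) → Vec a → Set ℓ
  Supported S γ = ∀ i → T (S i) ⊎ γ i ≈ 0#

  supported? : ∀ {a} (S : Fin a → Bool) γ → Dec (Supported S γ)
  supported? S γ = FinP.all? (λ i → T? (S i) ⊎-dec (γ i F.≈? 0#))

  count-supported : ∀ {a} (S : Fin a → Bool) → ∑[ V a ] (λ γ → 𝟙 (supported? S γ)) ≡ q ^ card S
  count-supported {zero}  S = cong (_+ 0) (𝟙-yes (supported? S (λ ())) (λ ()))
  count-supported {suc a} S = begin
    ∑[ V (suc a) ] (λ γ → 𝟙 (supported? S γ))                                ≡⟨ ∑-allFuns-suc elements a _ ⟩
    ∑[ 𝔽 ] (λ x → ∑[ V a ] (λ γ → 𝟙 (supported? S (x ∷ᶠ γ))))                ≡⟨ ∑-cong elements (λ x → ∑-cong (V.list {a}) (split x)) ⟩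
    ∑[ 𝔽 ] (λ x → ∑[ V a ] (λ γ → 𝟙 (head? x) * 𝟙 (supported? (S ∘ suc) γ))) ≡⟨ ∑-cong elements (λ x → ∑-*ˡ (V.list {a}) (𝟙 (head? x)) _) ⟩
    ∑[ 𝔽 ] (λ x → 𝟙 (head? x) * ∑[ V a ] (λ γ → 𝟙 (supported? (S ∘ suc) γ))) ≡⟨ ∑-*ʳ elements _ (λ x → 𝟙 (head? x)) ⟩
    ∑[ 𝔽 ] (λ x → 𝟙 (head? x)) * ∑[ V a ] (λ γ → 𝟙 (supported? (S ∘ suc) γ)) ≡⟨ cong₂ _*_ heads (count-supported (S ∘ suc)) ⟩
    q ^ ⟦ S zero ⟧ * q ^ card (S ∘ suc)                                      ≡⟨ ≡.sym (^-distribˡ-+-* q ⟦ S zero ⟧ _) ⟩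
    q ^ (⟦ S zero ⟧ + card (S ∘ suc))                                        ≡⟨ cong (q ^_) (≡.sym (card-suc S)) ⟩
    q ^ card S                                                               ∎
    where
    head? : ∀ x → Dec (T (S zero) ⊎ x ≈ 0#)
    head? x = T? (S zero) ⊎-dec (x F.≈? 0#)
    split : ∀ x γ → 𝟙 (supported? S (x ∷ᶠ γ)) ≡ 𝟙 (head? x) * 𝟙 (supported? (S ∘ suc) γ)
    split x γ = ≡.trans
      (𝟙-cong (supported? S (x ∷ᶠ γ)) (head? x ×-dec supported? (S ∘ suc) γ)
        (λ s → s zero , s ∘ suc) (λ { (h , t) zero → h ; (h , t) (suc i) → t i }))
      (𝟙-× (head? x) (supported? (S ∘ suc) γ))
    heads : ∑[ 𝔽 ] (λ x → 𝟙 (head? x)) ≡ q ^ ⟦ S zero ⟧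
    heads with S zero
    ... | true  = ≡.trans (∑-one elements) (≡.sym (*-identityʳ q))
    ... | false = ≡.trans (∑-cong elements (λ x → 𝟙-cong (x F.≈? 0#) (0# F.≈? x) F.sym F.sym)) (Enumeration.once 𝔽 0#)

  Indep : ∀ {a b} → Mat F a b → (Fin a → Bool) → Set _
  Indep X S = ∀ γ → Supported S γ → γ · X ≋ 0v → γ ≋ 0v

  indepRows-⇔ : ∀ {a b} (X : Mat F a b) S → T (indepRows F X S) ⇔ Indep X S
  indepRows-⇔ {a} {b} X S = mk⇔ forth back
    where
    zeroᵇ : ∀ {n} → Vec n → Bool
    zeroᵇ {n} v = allFinᵇ n (λ i → isYes (v i F.≈? 0#))
    zeroᵇ-⇔ : ∀ {n} (v : Vec n) → T (zeroᵇ v) ⇔ v ≋ 0v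
    zeroᵇ-⇔ {n} v = mk⇔ (λ t i → to (T-isYes (v i F.≈? 0#)) (to (T-allFinᵇ n _) t i))
                       (λ e → from (T-allFinᵇ n _) (λ i → from (T-isYes (v i F.≈? 0#)) (e i)))
    suppᵇ : Vec a → Bool
    suppᵇ γ = allFinᵇ a (λ i → S i ∨ isYes (γ i F.≈? 0#))
    suppᵇ-⇔ : ∀ γ → T (suppᵇ γ) ⇔ Supported S γ
    suppᵇ-⇔ γ = mk⇔
      (λ t i → Data.Sum.map₂ (to (T-isYes (γ i F.≈? 0#))) (to T-∨ (to (T-allFinᵇ a _) t i)))
      (λ s → from (T-allFinᵇ a _) (λ i → from T-∨ (Data.Sum.map₂ (from (T-isYes (γ i F.≈? 0#))) (s i))))
    test : Vec a → Bool
    test γ = not (suppᵇ γ ∧ zeroᵇ (γ · X)) ∨ zeroᵇ γ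
    test-to : ∀ γ → T (test γ) → Supported S γ → γ · X ≋ 0v → γ ≋ 0v
    test-to γ t s e with to (T-∨ {not (suppᵇ γ ∧ zeroᵇ (γ · X))}) t
    ... | inj₁ n = ⊥-elim (to T-not n (from T-∧ (from (suppᵇ-⇔ γ) s , from (zeroᵇ-⇔ (γ · X)) e)))
    ... | inj₂ z = to (zeroᵇ-⇔ γ) z
    forth : T (indepRows F X S) → Indep X S
    forth t γ s e =
      -- The test runs over listed vectors only, so γ is replaced by the listed δ equivalent to it.
      let tδ , γ≋δ = All.lookupAny (to (T-allᵇ test (V.list {a})) t) (V.member γ) in
      V.trans γ≋δ (test-to _ tδ (λ i → Data.Sum.map₂ (F.trans (F.sym (γ≋δ i))) (s i))
        (V.trans (·-congˡ X (V.sym γ≋δ)) e))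
    back : Indep X S → T (indepRows F X S)
    back ind = from (T-allᵇ test (V.list {a})) (All.universal each (V.list {a}))
      where
      each : ∀ γ → T (test γ)
      each γ with T? (suppᵇ γ ∧ zeroᵇ (γ · X))
      ... | no n  = from (T-∨ {not (suppᵇ γ ∧ zeroᵇ (γ · X))}) (inj₁ (from T-not n))
      ... | yes t = let s , e = to T-∧ t in
        from (T-∨ {not (suppᵇ γ ∧ zeroᵇ (γ · X))}) (inj₂ (from (zeroᵇ-⇔ γ) (ind γ (to (suppᵇ-⇔ γ) s) (to (zeroᵇ-⇔ (γ · X)) e))))

  -- γ ↦ γ · X is injective on the vectors supported on an independent set of rows.
  indep-≤ : ∀ {a b} (X : Mat F a b) S → Indep X S → q ^ card S ≤ rowSize X
  indep-≤ {a} {b} X S ind = ≤-trans (≤-reflexive spread) (∑-mono (V.list {b}) preimages)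
    where
    P? : ∀ x γ → Dec (Supported S γ × γ · X ≋ x)
    P? x γ = supported? S γ ×-dec (γ · X ≋? x)
    spread : q ^ card S ≡ ∑[ V b ] (λ x → ∑[ V a ] (λ γ → 𝟙 (P? x γ)))
    spread = begin
      q ^ card S                                                                 ≡⟨ ≡.sym (count-supported S) ⟩
      ∑[ V a ] (λ γ → 𝟙 (supported? S γ))                                        ≡⟨ ∑-cong (V.list {a}) (λ γ → ≡.sym (≡.trans (cong (𝟙 (supported? S γ) *_) (V.once (γ · X))) (*-identityʳ _))) ⟩
      ∑[ V a ] (λ γ → 𝟙 (supported? S γ) * ∑[ V b ] (λ x → 𝟙 (γ · X ≋? x)))      ≡⟨ ∑-cong (V.list {a}) (λ γ → ≡.sym (∑-*ˡ (V.list {b}) (𝟙 (supported? S γ)) _)) ⟩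
      ∑[ V a ] (λ γ → ∑[ V b ] (λ x → 𝟙 (supported? S γ) * 𝟙 (γ · X ≋? x)))      ≡⟨ ∑-swap (V.list {a}) (V.list {b}) _ ⟩
      ∑[ V b ] (λ x → ∑[ V a ] (λ γ → 𝟙 (supported? S γ) * 𝟙 (γ · X ≋? x)))      ≡⟨ ∑-cong (V.list {b}) (λ x → ∑-cong (V.list {a}) (λ γ → ≡.sym (𝟙-× (supported? S γ) (γ · X ≋? x)))) ⟩
      ∑[ V b ] (λ x → ∑[ V a ] (λ γ → 𝟙 (P? x γ)))                               ∎
    preimages : ∀ x → ∑[ V a ] (λ γ → 𝟙 (P? x γ)) ≤ 𝟙 (x ∈row? X)
    preimages x = ≤-trans
      (V.∑-≤1 (P? x) resp (V.∃? (P? x) resp) unique)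
      (𝟙-mono (V.∃? (P? x) resp) (x ∈row? X) (λ (γ , _ , e) → γ , e))
      where
      resp : ∀ {γ δ} → γ ≋ δ → Supported S γ × γ · X ≋ x → Supported S δ × δ · X ≋ x
      resp γ≋δ (s , e) = (λ i → Data.Sum.map₂ (F.trans (F.sym (γ≋δ i))) (s i)) , V.trans (·-congˡ X (V.sym γ≋δ)) e
      unique : ∀ {γ δ} → Supported S γ × γ · X ≋ x → Supported S δ × δ · X ≋ x → γ ≋ δ
      unique {γ} {δ} (s , e) (s′ , e′) i = -≈0⇒≈ (ind (γ ⊟ δ) supp
        (λ j → F.trans (·-⊟ γ δ X j) (≈⇒-≈0 (F.trans (e j) (F.sym (e′ j))))) i)
        where
        supp : Supported S (γ ⊟ δ)
        supp i with s i | s′ i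
        ... | inj₁ t | _      = inj₁ t
        ... | inj₂ _ | inj₁ t = inj₁ t
        ... | inj₂ z | inj₂ w = inj₂ (≈⇒-≈0 (F.trans z (F.sym w)))

  drop-head : ∀ {a b} (X : Mat F (suc a) b) γ → γ zero ≈ 0# → γ · X ≋ 0v → (γ ∘ suc) · (X ∘ suc) ≋ 0v
  drop-head X γ γ₀≈0 e j = F.trans (F.sym (F.+-identityˡ _)) (F.trans
    (F.+-congʳ (F.sym (F.trans (F.*-congʳ γ₀≈0) (F.zeroˡ (X zero j))))) (F.trans (F.sym (·-suc γ X j)) (e j)))

  -- Greedy choice from the last row upwards: a row joins `S` exactly when it lies outside the span
  -- of the rows below it. By `ker-suc` a dependent row multiplies the kernel by q, while an
  -- independent one increases `card S`; either way the product gains one factor q.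
  ∃-basis : ∀ {a b} (X : Mat F a b) → ∃ λ S → Indep X S × q ^ card S * ker X ≡ q ^ a
  ∃-basis {zero}  X = (λ ()) , (λ γ _ _ ()) ,
    ≡.trans (*-identityˡ (ker X)) (cong (_+ 0) (𝟙-yes ((λ ()) · X ≋? 0v) (·-0v X)))
  ∃-basis {suc a} X with X zero ∈row? (X ∘ suc) | ∃-basis (X ∘ suc)
  ... | yes x∈ | S , ind , size = (false ∷ᶠ S) , indep , (begin
    q ^ card (false ∷ᶠ S) * ker X  ≡⟨ cong₂ _*_ (cong (q ^_) (card-suc (false ∷ᶠ S))) (≡.trans (ker-suc X (yes x∈)) (cong (_* ker (X ∘ suc)) (≡.trans (+-identityʳ _) (+-identityʳ q)))) ⟩
    q ^ card S * (q * ker (X ∘ suc)) ≡⟨ ≡.sym (*-assoc (q ^ card S) q _) ⟩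
    q ^ card S * q * ker (X ∘ suc) ≡⟨ cong (_* ker (X ∘ suc)) (*-comm (q ^ card S) q) ⟩
    q * q ^ card S * ker (X ∘ suc) ≡⟨ *-assoc q _ _ ⟩
    q * (q ^ card S * ker (X ∘ suc)) ≡⟨ cong (q *_) size ⟩
    q ^ suc a                      ∎)
    where
    indep : Indep X (false ∷ᶠ S)
    indep γ s e = λ { zero → γ₀≈0 ; (suc i) → tail i }
      where
      γ₀≈0 : γ zero ≈ 0#
      γ₀≈0 with s zero
      ... | inj₂ z = z
      tail = ind (γ ∘ suc) (s ∘ suc) (drop-head X γ γ₀≈0 e)
  ... | no x∉  | S , ind , size = (true ∷ᶠ S) , indep , (begin
    q ^ card (true ∷ᶠ S) * ker X       ≡⟨ cong₂ _*_ (cong (q ^_) (card-suc (true ∷ᶠ S))) (≡.trans (ker-suc X (no x∉)) (+-identityʳ _)) ⟩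
    q * q ^ card S * ker (X ∘ suc)     ≡⟨ *-assoc q _ _ ⟩
    q * (q ^ card S * ker (X ∘ suc))   ≡⟨ cong (q *_) size ⟩
    q ^ suc a                          ∎)
    where
    indep : Indep X (true ∷ᶠ S)
    indep γ s e with γ zero F.≈? 0#
    -- A relation with nonzero leading coefficient could be divided by it and would put the first
    -- row into the span of the others.
    ... | no γ₀≉0  = ⊥-elim (x∉ (∈row-unscale (X ∘ suc) (λ z → γ₀≉0 (-≈0⇒≈0 z)) (γ ∘ suc , solve-head X γ e)))
    ... | yes γ₀≈0 = λ { zero → γ₀≈0 ; (suc i) → tail i }
      where
      tail = ind (γ ∘ suc) (s ∘ suc) (drop-head X γ γ₀≈0 e)

  bools : Enumeration _ _
  bools = record
    { decSetoid = bool-decSetoid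
    ; list      = true ∷ false ∷ []
    ; once      = λ { true → ≡.refl ; false → ≡.refl }
    }

  max-filter-≤ : ∀ {x} {A : Set x} (φ : A → Bool) (f : A → ℕ) n → (∀ y → T (φ y) → f y ≤ n) →
    ∀ ys → foldr _⊔_ 0 (map f (filterᵇ φ ys)) ≤ n
  max-filter-≤ φ f n bound []       = z≤n
  max-filter-≤ φ f n bound (y ∷ ys) with φ y | bound y
  ... | true  | b = ⊔-lub (b _) (max-filter-≤ φ f n bound ys)
  ... | false | _ = max-filter-≤ φ f n bound ys

  max-filter-≥ : ∀ {x} {A : Set x} (φ : A → Bool) (f : A → ℕ) n ys → Any (λ y → T (φ y) × n ≤ f y) ys →
    n ≤ foldr _⊔_ 0 (map f (filterᵇ φ ys))
  max-filter-≥ φ f n (y ∷ ys) (here (t , le)) with φ y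
  ... | true = ≤-trans le (m≤m⊔n (f y) _)
  max-filter-≥ φ f n (y ∷ ys) (there y∈) with φ y
  ... | true  = ≤-trans (max-filter-≥ φ f n ys y∈) (m≤n⊔m (f y) _)
  ... | false = max-filter-≥ φ f n ys y∈

  -- The greedy set `S` attains the maximum that defines `rank`: any independent set S′ satisfies q
  -- ^ card S′ ≤ `rowSize X`, and the row space has q ^ card S elements.
  rank-ker : ∀ {a b} (X : Mat F a b) → q ^ rank F X * ker X ≡ q ^ a
  rank-ker {a} X with ∃-basis X
  ... | S , ind , size = ≡.trans (cong (λ r → q ^ r * ker X) rank≡) size
    where
    upper : ∀ S′ → T (indepRows F X S′) → card S′ ≤ card S
    upper S′ t = q^-cancel-≤ (*-cancelʳ-≤ _ _ (ker X) {{ker≢0 X}} (≤-trans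
      (*-monoˡ-≤ (ker X) (indep-≤ X S′ (to (indepRows-⇔ X S′) t)))
      (≤-reflexive (≡.trans (*-comm _ (ker X)) (≡.trans (ker*rowSize X) (≡.sym size))))))
    -- The list of subsets contains `S` only up to pointwise equality, so independence and size are
    -- transported to the listed copy.
    lower : ∀ {S′} → S ≗ S′ → T (indepRows F X S′) × card S ≤ card S′
    lower {S′} e = from (indepRows-⇔ X S′) (λ γ s → ind γ (λ i → Data.Sum.map₁ (subst T (≡.sym (e i))) (s i)))
                 , ≤-reflexive (≡.trans (card≡∑ S) (≡.trans (∑-cong (allFin a) (λ i → cong ⟦_⟧ (e i))) (≡.sym (card≡∑ S′))))
    rank≡ : rank F X ≡ card S
    rank≡ = ≤-antisym
      (max-filter-≤ (indepRows F X) card (card S) upper (allFuns (true ∷ false ∷ []) a))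
      (max-filter-≥ (indepRows F X) card (card S) (allFuns (true ∷ false ∷ []) a) (Any.map lower (Enumeration.member (functions bools a) S)))

  rowSize≡q^rank : ∀ {a b} (X : Mat F a b) → rowSize X ≡ q ^ rank F X
  rowSize≡q^rank X = *-cancelˡ-≡ _ _ (ker X) {{ker≢0 X}} (≡.trans (ker*rowSize X) (≡.trans (≡.sym (rank-ker X)) (*-comm _ (ker X))))

  -- By `rank-ker` the rank is determined by the number of rows and the left kernel. In particular
  -- it respects pointwise equality of matrices.
  rank-from-ker : ∀ {a b d} (X : Mat F a b) (Y : Mat F a d) →
    (∀ γ → γ · X ≋ 0v → γ · Y ≋ 0v) → (∀ γ → γ · Y ≋ 0v → γ · X ≋ 0v) → rank F X ≡ rank F Y
  rank-from-ker {a} X Y f g = q^-injective (*-cancelʳ-≡ _ _ (ker X) {{ker≢0 X}}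
    (≡.trans (rank-ker X) (≡.trans (≡.sym (rank-ker Y)) (cong (q ^ rank F Y *_) (≡.sym ker≡)))))
    where
    ker≡ : ker X ≡ ker Y
    ker≡ = ∑-cong (V.list {a}) (λ γ → 𝟙-cong (γ · X ≋? 0v) (γ · Y ≋? 0v) (f γ) (g γ))

  rank-cong : ∀ {a b} {X Y : Mat F a b} → (∀ i → X i ≋ Y i) → rank F X ≡ rank F Y
  rank-cong {X = X} {Y} e = rank-from-ker X Y
    (λ γ → V.trans (·-cong {X = Y} {X} V.refl (λ i → V.sym (e i))))
    (λ γ → V.trans (·-cong {X = X} {Y} V.refl e))

  rank≤rows : ∀ {a b} (X : Mat F a b) → rank F X ≤ a
  rank≤rows X = q^-cancel-≤ (≤-trans (m≤m*n _ (ker X) {{ker≢0 X}}) (≤-reflexive (rank-ker X)))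

  rank-suc : ∀ {a b} (X : Mat F (suc a) b) (x∈? : Dec (X zero ∈row (X ∘ suc))) →
    rank F X ≡ 𝟙 (¬? x∈?) + rank F (X ∘ suc)
  rank-suc {a} X x∈? = q^-injective (cancel x∈? (begin
    q ^ rank F X * ((𝟙 x∈? * q + 𝟙 (¬? x∈?)) * ker X′) ≡⟨ cong (q ^ rank F X *_) (≡.sym (ker-suc X x∈?)) ⟩
    q ^ rank F X * ker X                               ≡⟨ rank-ker X ⟩
    q * q ^ a                                          ≡⟨ cong (q *_) (≡.sym (rank-ker X′)) ⟩
    q * (q ^ rank F X′ * ker X′)                       ≡⟨ ≡.sym (*-assoc q _ _) ⟩
    q ^ suc (rank F X′) * ker X′                       ∎))
    where
    X′ = X ∘ suc
    cancel : (d : Dec (X zero ∈row X′)) →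
      q ^ rank F X * ((𝟙 d * q + 𝟙 (¬? d)) * ker X′) ≡ q ^ suc (rank F X′) * ker X′ →
      q ^ rank F X ≡ q ^ (𝟙 (¬? d) + rank F X′)
    cancel (no _)  e = *-cancelʳ-≡ _ _ (ker X′) {{ker≢0 X′}} (≡.trans (cong (q ^ rank F X *_) (≡.sym (+-identityʳ (ker X′)))) e)
    cancel (yes _) e = *-cancelʳ-≡ _ _ q (*-cancelʳ-≡ _ _ (ker X′) {{ker≢0 X′}} (begin
      q ^ rank F X * q * ker X′           ≡⟨ *-assoc (q ^ rank F X) q _ ⟩
      q ^ rank F X * (q * ker X′)         ≡⟨ cong (λ z → q ^ rank F X * (z * ker X′)) (≡.sym (≡.trans (+-identityʳ _) (+-identityʳ q))) ⟩
      q ^ rank F X * ((1 * q + 0) * ker X′) ≡⟨ e ⟩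
      q * q ^ rank F X′ * ker X′          ≡⟨ cong (_* ker X′) (*-comm q _) ⟩
      q ^ rank F X′ * q * ker X′          ∎))

-- Row rank equals column rank, by double counting

module Counting {c ℓ} (F : FiniteField c ℓ) where
  private module F = FiniteField F
  open F using (Carrier; _≈_; 0#; 1#) renaming (_*_ to _⊗_)
  open LinearAlgebra F
  open Rank F
  open V using () renaming (_≈_ to _≋_; _≟_ to _≋?_)

  sumF-single : ∀ n {f : Vec n} i → (∀ k → ¬ (i ≡ k) → f k ≈ 0#) → sumF F f ≈ f i
  sumF-single (suc n) {f} zero    z = F.trans (sumF-suc f) (F.trans (F.+-congˡ (sumF-zero n (λ k → z (suc k) λ ()))) (F.+-identityʳ _))
  sumF-single (suc n) {f} (suc i) z = F.trans (sumF-suc f) (F.trans (F.+-cong (z zero λ ()) (sumF-single n i (λ k i≢k → z (suc k) (λ e → i≢k (FinP.suc-injective e))))) (F.+-identityˡ _))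

  _ᵗ : ∀ {x} {A : Set x} {a b} → (Fin a → Fin b → A) → Fin b → Fin a → A
  (X ᵗ) j i = X i j

  dot : ∀ {n} → Vec n → Vec n → Carrier
  dot u v = sumF F (λ i → u i ⊗ v i)

  dot-adjoint : ∀ {a b} (X : Mat F a b) γ v → dot v (γ · X) ≈ dot γ (v · X ᵗ)
  dot-adjoint {a} {b} X γ v = begin
    sumF F (λ k → v k ⊗ sumF F (λ i → γ i ⊗ X i k))    ≈⟨ sumF-cong b (λ k → F.sym (sumF-⊗ˡ (v k) (λ i → γ i ⊗ X i k))) ⟩
    sumF F (λ k → sumF F (λ i → v k ⊗ (γ i ⊗ X i k)))  ≈⟨ sumF-swap (λ k i → v k ⊗ (γ i ⊗ X i k)) ⟩
    sumF F (λ i → sumF F (λ k → v k ⊗ (γ i ⊗ X i k)))  ≈⟨ sumF-cong a (λ i → F.trans (sumF-cong b (λ k → exchange (v k) (γ i) (X i k))) (sumF-⊗ˡ (γ i) (λ k → v k ⊗ X i k))) ⟩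
    sumF F (λ i → γ i ⊗ sumF F (λ k → v k ⊗ X i k))    ∎
    where
    open SetoidReasoning F.setoid
    exchange : ∀ x y z → x ⊗ (y ⊗ z) ≈ y ⊗ (x ⊗ z)
    exchange x y z = F.trans (F.sym (F.*-assoc x y z)) (F.trans (F.*-congʳ (F.*-comm x y)) (F.*-assoc y x z))

  open ≡.≡-Reasoning

  -- A nonzero `w` is orthogonal to q^(b-1) vectors and the zero vector to all q^b. The factor q
  -- avoids the exponent b - 1, and the excess (q - 1) q^b marks exactly the case w = 0.
  hyperplane : ∀ {b} (w : Vec b) → q * ∑[ V b ] (λ v → 𝟙 (dot v w F.≈? 0#)) ≡ q ^ b + 𝟙 (w ≋? 0v) * ((q ∸ 1) * q ^ b)
  hyperplane {b} w = by (w ≋? 0v)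
    where
    W : Mat F b 1
    W i _ = w i
    by : (d : Dec (w ≋ 0v)) → q * ∑[ V b ] (λ v → 𝟙 (dot v w F.≈? 0#)) ≡ q ^ b + 𝟙 d * ((q ∸ 1) * q ^ b)
    by (yes w≋0) = begin
      q * ∑[ V b ] (λ v → 𝟙 (dot v w F.≈? 0#))  ≡⟨ cong (q *_) (∑-cong (V.list {b}) (λ v → 𝟙-yes (dot v w F.≈? 0#) (sumF-zero b (λ i → F.trans (F.*-congˡ (w≋0 i)) (F.zeroʳ (v i)))))) ⟩
      q * ∑[ V b ] (λ v → 1)                    ≡⟨ cong (q *_) (|V| b) ⟩
      q * q ^ b                                 ≡⟨ cong (_* q ^ b) (≡.sym (m+[n∸m]≡n (<⇒≤ 1<q))) ⟩
      (1 + (q ∸ 1)) * q ^ b                     ≡⟨ cong (q ^ b +_) (≡.sym (*-identityˡ _)) ⟩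
      q ^ b + 1 * ((q ∸ 1) * q ^ b)             ∎
    by (no w≋̸0) = begin
      -- Read as a matrix with one column, `w` has its orthogonal vectors as left kernel, and its
      -- row space is the whole field.
      q * ∑[ V b ] (λ v → 𝟙 (dot v w F.≈? 0#))  ≡⟨ cong (q *_) (∑-cong (V.list {b}) (λ v → 𝟙-cong (dot v w F.≈? 0#) (v · W ≋? 0v) (λ e _ → e) (λ e → e zero))) ⟩
      q * ker W                                 ≡⟨ *-comm q _ ⟩
      ker W * q                                 ≡⟨ cong (ker W *_) (≡.sym full) ⟩
      ker W * rowSize W                         ≡⟨ ker*rowSize W ⟩
      q ^ b                                     ≡⟨ ≡.sym (+-identityʳ _) ⟩
      q ^ b + 0                                 ∎
      where
      pivot = FinP.¬∀⟶∃¬ b (λ i → w i ≈ 0#) (λ i → w i F.≈? 0#) w≋̸0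
      p = proj₁ pivot
      inv = F.inverse (w p) (proj₂ pivot)
      e : Vec b
      e k = if does (p Fin.≟ k) then 1# else 0#
      e-off : ∀ k → ¬ (p ≡ k) → e k ⊗ w k ≈ 0#
      e-off k p≢k with p Fin.≟ k
      ... | yes p≡k = ⊥-elim (p≢k p≡k)
      ... | no _    = F.zeroˡ (w k)
      e-on : e p ≈ 1#
      e-on with p Fin.≟ p
      ... | yes _ = F.refl
      ... | no ne = ⊥-elim (ne ≡.refl)
      in-row : ∀ y → y ∈row W
      -- The unit vector `e` at the pivot is mapped to `w p`, so y · e is mapped to w p times y, and
      -- the nonzero `w p` is divided out.
      in-row y = ∈row-unscale W (proj₂ pivot) (y zero ⊙ e , λ { zero → F.trans (·-⊙ (y zero) e W zero)
        (F.trans (F.*-congˡ (F.trans (sumF-single b p e-off) (F.trans (F.*-congʳ e-on) (F.*-identityˡ _)))) (F.*-comm _ _)) })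
      full : rowSize W ≡ q
      full = ≡.trans (∑-cong (V.list {1}) (λ y → 𝟙-yes (y ∈row? W) (in-row y))) (≡.trans (|V| 1) (*-identityʳ q))

  -- Count the pairs (γ , v) with γ X v = 0 first by γ, then by v.
  ker-ᵗ : ∀ {a b} (X : Mat F a b) → ker X * q ^ b ≡ ker (X ᵗ) * q ^ a
  -- Both counts contain q ^ a * q ^ b. Once it is cancelled, the kernels are compared up to the
  -- positive factor q - 1.
  ker-ᵗ {a} {b} X = *-cancelˡ-≡ _ _ (q ∸ 1) {{>-nonZero (m<n⇒0<n∸m 1<q)}} (begin
    (q ∸ 1) * (ker X * q ^ b)       ≡⟨ exchange (q ∸ 1) (ker X) _ ⟩
    ker X * ((q ∸ 1) * q ^ b)       ≡⟨ +-cancelˡ-≡ (q ^ a * q ^ b) _ _ (≡.trans (≡.sym (by-first X)) (≡.trans (cong (q *_) swapped)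
                                         (≡.trans (by-first (X ᵗ)) (cong (_+ ker (X ᵗ) * ((q ∸ 1) * q ^ a)) (*-comm (q ^ b) _))))) ⟩
    ker (X ᵗ) * ((q ∸ 1) * q ^ a)   ≡⟨ exchange (ker (X ᵗ)) (q ∸ 1) _ ⟩
    (q ∸ 1) * (ker (X ᵗ) * q ^ a)   ∎)
    where
    exchange : ∀ x y z → x * (y * z) ≡ y * (x * z)
    exchange x y z = ≡.trans (≡.sym (*-assoc x y z)) (≡.trans (cong (_* z) (*-comm x y)) (*-assoc y x z))
    pairs : ∀ {a b} → Mat F a b → ℕ
    pairs {a} {b} X = ∑[ V a ] (λ γ → ∑[ V b ] (λ v → 𝟙 (dot v (γ · X) F.≈? 0#)))
    swapped : pairs X ≡ pairs (X ᵗ)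
    swapped = ≡.trans (∑-swap (V.list {a}) (V.list {b}) _) (∑-cong (V.list {b}) (λ v → ∑-cong (V.list {a}) (λ γ →
      𝟙-cong (dot v (γ · X) F.≈? 0#) (dot γ (v · X ᵗ) F.≈? 0#) (F.trans (F.sym (dot-adjoint X γ v))) (F.trans (dot-adjoint X γ v)))))
    by-first : ∀ {a b} (X : Mat F a b) → q * pairs X ≡ q ^ a * q ^ b + ker X * ((q ∸ 1) * q ^ b)
    by-first {a} {b} X = begin
      q * pairs X                                                             ≡⟨ ≡.sym (∑-*ˡ (V.list {a}) q _) ⟩
      ∑[ V a ] (λ γ → q * ∑[ V b ] (λ v → 𝟙 (dot v (γ · X) F.≈? 0#)))         ≡⟨ ∑-cong (V.list {a}) (λ γ → hyperplane (γ · X)) ⟩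
      ∑[ V a ] (λ γ → q ^ b + 𝟙 (γ · X ≋? 0v) * ((q ∸ 1) * q ^ b))            ≡⟨ ∑-+ (V.list {a}) (λ _ → q ^ b) _ ⟩
      ∑[ V a ] (λ γ → q ^ b) + ∑[ V a ] (λ γ → 𝟙 (γ · X ≋? 0v) * ((q ∸ 1) * q ^ b)) ≡⟨ cong₂ _+_
        (≡.trans (∑-cong (V.list {a}) (λ _ → ≡.sym (*-identityˡ _))) (≡.trans (∑-*ʳ (V.list {a}) (q ^ b) (λ _ → 1)) (cong (_* q ^ b) (|V| a))))
        (∑-*ʳ (V.list {a}) ((q ∸ 1) * q ^ b) _) ⟩
      q ^ a * q ^ b + ker X * ((q ∸ 1) * q ^ b)                               ∎

  -- By `rank-ker`, applied to X and to its transpose, the powers q ^ a and q ^ b in `ker-ᵗ` turn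
  -- into products in which both kernel sizes occur and cancel.
  rank-ᵗ : ∀ {a b} (X : Mat F a b) → rank F (X ᵗ) ≡ rank F X
  rank-ᵗ {a} {b} X = q^-injective (*-cancelˡ-≡ _ _ (ker X * ker (X ᵗ)) {{m*n≢0 (ker X) (ker (X ᵗ)) {{ker≢0 X}} {{ker≢0 (X ᵗ)}}}} (begin
    ker X * ker (X ᵗ) * q ^ rank F (X ᵗ)      ≡⟨ *-assoc (ker X) _ _ ⟩
    ker X * (ker (X ᵗ) * q ^ rank F (X ᵗ))    ≡⟨ cong (ker X *_) (≡.trans (*-comm (ker (X ᵗ)) _) (rank-ker (X ᵗ))) ⟩
    ker X * q ^ b                             ≡⟨ ker-ᵗ X ⟩
    ker (X ᵗ) * q ^ a                         ≡⟨ cong (ker (X ᵗ) *_) (≡.sym (≡.trans (*-comm (ker X) _) (rank-ker X))) ⟩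
    ker (X ᵗ) * (ker X * q ^ rank F X)        ≡⟨ ≡.sym (*-assoc (ker (X ᵗ)) _ _) ⟩
    ker (X ᵗ) * ker X * q ^ rank F X          ≡⟨ cong (_* q ^ rank F X) (*-comm (ker (X ᵗ)) _) ⟩
    ker X * ker (X ᵗ) * q ^ rank F X          ∎))

-- Counting matrices of given rank row by row

module Recursions {c ℓ} (F : FiniteField c ℓ) where
  private module F = FiniteField F

  open LinearAlgebra F
  open Rank F
  open Counting F
  open V using () renaming (_≈_ to _≋_; _≟_ to _≋?_)
  open ≡.≡-Reasoning

  infix 4 _≟ℕ_
  _≟ℕ_ = Data.Nat._≟_

  -- Replaces a rank that varies with the matrix by the constant it is tested against, so that the
  -- factor can leave the sum over matrices.
  𝟙≟-* : ∀ n r (f : ℕ → ℕ) → 𝟙 (n ≟ℕ r) * f n ≡ 𝟙 (n ≟ℕ r) * f r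
  𝟙≟-* n r f = 𝟙-*-cong (n ≟ℕ r) (cong f)

  matrices : ℕ → ℕ → Enumeration _ _
  matrices a b = functions (V b) a

  cardMatsOfRank≡∑ : ∀ a b r → cardMatsOfRank F a b r ≡ ∑ (allMats F a b) (λ X → 𝟙 (rank F X ≟ℕ r))
  cardMatsOfRank≡∑ a b r = ≡.trans (length-filter _ (allMats F a b))
    (∑-cong (allMats F a b) (λ X → isYes≡𝟙 (rank F X ≟ℕ r)))

  -- The new row is summed innermost, hence counted while the rest of the matrix is fixed.
  ∑-allMats-suc : ∀ a b (f : Mat F (suc a) b → ℕ) →
    ∑ (allMats F (suc a) b) f ≡ ∑ (allMats F a b) (λ X → ∑[ V b ] (λ x → f (x ∷ᶠ X)))
  ∑-allMats-suc a b f = ≡.trans (∑-allFuns-suc (V.list {b}) a f) (∑-swap (V.list {b}) (allMats F a b) _)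

  rank-∷-zero : ∀ {a b} (x : Vec b) (X : Mat F a b) (x∈? : Dec (x ∈row X)) →
    𝟙 (rank F (x ∷ᶠ X) ≟ℕ 0) ≡ 𝟙 x∈? * 𝟙 (rank F X ≟ℕ 0)
  rank-∷-zero x X x∈?@(yes _) = ≡.trans (cong (λ s → 𝟙 (s ≟ℕ 0)) (rank-suc (x ∷ᶠ X) x∈?)) (≡.sym (+-identityʳ _))
  rank-∷-zero x X x∈?@(no _)  = cong (λ s → 𝟙 (s ≟ℕ 0)) (rank-suc (x ∷ᶠ X) x∈?)

  rank-∷-suc : ∀ {a b} (x : Vec b) (X : Mat F a b) (x∈? : Dec (x ∈row X)) r →
    𝟙 (rank F (x ∷ᶠ X) ≟ℕ suc r) ≡ 𝟙 x∈? * 𝟙 (rank F X ≟ℕ suc r) + 𝟙 (¬? x∈?) * 𝟙 (rank F X ≟ℕ r)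
  rank-∷-suc x X x∈?@(yes _) r = ≡.trans (cong (λ s → 𝟙 (s ≟ℕ suc r)) (rank-suc (x ∷ᶠ X) x∈?))
    (≡.sym (≡.trans (+-identityʳ _) (+-identityʳ _)))
  rank-∷-suc x X x∈?@(no _)  r = ≡.trans (cong (λ s → 𝟙 (s ≟ℕ suc r)) (rank-suc (x ∷ᶠ X) x∈?))
    (≡.trans (𝟙-cong (suc (rank F X) ≟ℕ suc r) (rank F X ≟ℕ r) suc-injective (cong suc)) (≡.sym (+-identityʳ _)))

  rank-∷-full : ∀ {a b} (x : Vec b) (X : Mat F a b) (x∈? : Dec (x ∈row X)) →
    𝟙 (rank F (x ∷ᶠ X) ≟ℕ suc a) ≡ 𝟙 (rank F X ≟ℕ a) * 𝟙 (¬? x∈?)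
  rank-∷-full {a} x X x∈? = begin
    𝟙 (rank F (x ∷ᶠ X) ≟ℕ suc a)                                            ≡⟨ rank-∷-suc x X x∈? a ⟩
    𝟙 x∈? * 𝟙 (rank F X ≟ℕ suc a) + 𝟙 (¬? x∈?) * 𝟙 (rank F X ≟ℕ a)          ≡⟨ cong (λ z → 𝟙 x∈? * z + 𝟙 (¬? x∈?) * 𝟙 (rank F X ≟ℕ a))
                                                                                 (𝟙-no (rank F X ≟ℕ suc a) (<⇒≢ (s≤s (rank≤rows X)))) ⟩
    𝟙 x∈? * 0 + 𝟙 (¬? x∈?) * 𝟙 (rank F X ≟ℕ a)                              ≡⟨ cong₂ _+_ (*-zeroʳ (𝟙 x∈?)) (*-comm (𝟙 (¬? x∈?)) _) ⟩
    𝟙 (rank F X ≟ℕ a) * 𝟙 (¬? x∈?)                                          ∎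

  count-outside-row : ∀ {a b} (X : Mat F a b) → ∑[ V b ] (λ x → 𝟙 (¬? (x ∈row? X))) ≡ q ^ b ∸ q ^ rank F X
  count-outside-row {a} {b} X = begin
    ∑[ V b ] (λ x → 𝟙 (¬? (x ∈row? X)))                                ≡⟨ ∑-cong (V.list {b}) (λ x → ≡.sym (*-identityʳ _)) ⟩
    ∑[ V b ] (λ x → 𝟙 (¬? (x ∈row? X)) * 1)                            ≡⟨ count-∖ (V.list {b}) (λ _ → yes tt) (_∈row? X) (λ _ _ → tt) ⟩
    ∑[ V b ] (λ _ → 1) ∸ rowSize X                                     ≡⟨ cong₂ _∸_ (|V| b) (rowSize≡q^rank X) ⟩
    q ^ b ∸ q ^ rank F X                                               ∎

  -- The recursion for the number of l × d matrices of rank r, by adding a row inside or outside the row space.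
  rankCount : ℕ → ℕ → ℕ → ℕ
  rankCount d zero    zero    = 1
  rankCount d zero    (suc r) = 0
  rankCount d (suc l) zero    = rankCount d l zero
  rankCount d (suc l) (suc r) = rankCount d l (suc r) * q ^ suc r + rankCount d l r * (q ^ d ∸ q ^ r)

  cardMatsOfRank≡rankCount : ∀ l d r → cardMatsOfRank F l d r ≡ rankCount d l r
  cardMatsOfRank≡rankCount l d r = ≡.trans (cardMatsOfRank≡∑ l d r) (go l r)
    where
    go : ∀ l r → ∑ (allMats F l d) (λ X → 𝟙 (rank F X ≟ℕ r)) ≡ rankCount d l r
    go zero r = ≡.trans (+-identityʳ _) (≡.trans (cong (λ s → 𝟙 (s ≟ℕ r)) (n≤0⇒n≡0 (rank≤rows {b = d} (λ ())))) (empty r))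
      where
      empty : ∀ r → 𝟙 (0 ≟ℕ r) ≡ rankCount d zero r
      empty zero    = ≡.refl
      empty (suc r) = ≡.refl
    go (suc l) zero = begin
      ∑ (allMats F (suc l) d) (λ X → 𝟙 (rank F X ≟ℕ 0))                           ≡⟨ ∑-allMats-suc l d _ ⟩
      ∑ (allMats F l d) (λ X → ∑[ V d ] (λ x → 𝟙 (rank F (x ∷ᶠ X) ≟ℕ 0)))          ≡⟨ ∑-cong (allMats F l d) step ⟩
      ∑ (allMats F l d) (λ X → 𝟙 (rank F X ≟ℕ 0))                                 ≡⟨ go l zero ⟩
      rankCount d l zero                                                         ∎
      where
      step : ∀ X → ∑[ V d ] (λ x → 𝟙 (rank F (x ∷ᶠ X) ≟ℕ 0)) ≡ 𝟙 (rank F X ≟ℕ 0)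
      step X = begin
        ∑[ V d ] (λ x → 𝟙 (rank F (x ∷ᶠ X) ≟ℕ 0))               ≡⟨ ∑-cong (V.list {d}) (λ x → rank-∷-zero x X (x ∈row? X)) ⟩
        ∑[ V d ] (λ x → 𝟙 (x ∈row? X) * 𝟙 (rank F X ≟ℕ 0))      ≡⟨ ∑-*ʳ (V.list {d}) (𝟙 (rank F X ≟ℕ 0)) _ ⟩
        rowSize X * 𝟙 (rank F X ≟ℕ 0)                           ≡⟨ ≡.trans (*-comm (rowSize X) _) (cong (𝟙 (rank F X ≟ℕ 0) *_) (rowSize≡q^rank X)) ⟩
        𝟙 (rank F X ≟ℕ 0) * q ^ rank F X                        ≡⟨ 𝟙≟-* (rank F X) 0 (q ^_) ⟩
        𝟙 (rank F X ≟ℕ 0) * 1                                   ≡⟨ *-identityʳ _ ⟩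
        𝟙 (rank F X ≟ℕ 0)                                       ∎
    go (suc l) (suc r) = begin
      ∑ (allMats F (suc l) d) (λ X → 𝟙 (rank F X ≟ℕ suc r))                       ≡⟨ ∑-allMats-suc l d _ ⟩
      ∑ (allMats F l d) (λ X → ∑[ V d ] (λ x → 𝟙 (rank F (x ∷ᶠ X) ≟ℕ suc r)))      ≡⟨ ∑-cong (allMats F l d) step ⟩
      ∑ (allMats F l d) (λ X → 𝟙 (rank F X ≟ℕ suc r) * q ^ suc r + 𝟙 (rank F X ≟ℕ r) * (q ^ d ∸ q ^ r))
        ≡⟨ ∑-+ (allMats F l d) _ _ ⟩
      ∑ (allMats F l d) (λ X → 𝟙 (rank F X ≟ℕ suc r) * q ^ suc r) + ∑ (allMats F l d) (λ X → 𝟙 (rank F X ≟ℕ r) * (q ^ d ∸ q ^ r))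
        ≡⟨ cong₂ _+_ (∑-*ʳ (allMats F l d) (q ^ suc r) _) (∑-*ʳ (allMats F l d) (q ^ d ∸ q ^ r) _) ⟩
      ∑ (allMats F l d) (λ X → 𝟙 (rank F X ≟ℕ suc r)) * q ^ suc r + ∑ (allMats F l d) (λ X → 𝟙 (rank F X ≟ℕ r)) * (q ^ d ∸ q ^ r)
        ≡⟨ cong₂ (λ u v → u * q ^ suc r + v * (q ^ d ∸ q ^ r)) (go l (suc r)) (go l r) ⟩
      rankCount d (suc l) (suc r)                                                 ∎
      where
      step : ∀ X → ∑[ V d ] (λ x → 𝟙 (rank F (x ∷ᶠ X) ≟ℕ suc r)) ≡ 𝟙 (rank F X ≟ℕ suc r) * q ^ suc r + 𝟙 (rank F X ≟ℕ r) * (q ^ d ∸ q ^ r)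
      step X = begin
        ∑[ V d ] (λ x → 𝟙 (rank F (x ∷ᶠ X) ≟ℕ suc r))                                              ≡⟨ ∑-cong (V.list {d}) (λ x → rank-∷-suc x X (x ∈row? X) r) ⟩
        ∑[ V d ] (λ x → 𝟙 (x ∈row? X) * u + 𝟙 (¬? (x ∈row? X)) * v)                                ≡⟨ ∑-+ (V.list {d}) _ _ ⟩
        ∑[ V d ] (λ x → 𝟙 (x ∈row? X) * u) + ∑[ V d ] (λ x → 𝟙 (¬? (x ∈row? X)) * v)               ≡⟨ cong₂ _+_ (∑-*ʳ (V.list {d}) u _) (∑-*ʳ (V.list {d}) v _) ⟩
        rowSize X * u + ∑[ V d ] (λ x → 𝟙 (¬? (x ∈row? X))) * v                                    ≡⟨ cong₂ _+_ (*-comm (rowSize X) u) (*-comm _ v) ⟩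
        u * rowSize X + v * ∑[ V d ] (λ x → 𝟙 (¬? (x ∈row? X)))                                    ≡⟨ cong₂ (λ y z → u * y + v * z) (rowSize≡q^rank X) (count-outside-row X) ⟩
        u * q ^ rank F X + v * (q ^ d ∸ q ^ rank F X)                                              ≡⟨ cong₂ _+_ (𝟙≟-* (rank F X) (suc r) (q ^_)) (𝟙≟-* (rank F X) r (λ s → q ^ d ∸ q ^ s)) ⟩
        u * q ^ suc r + v * (q ^ d ∸ q ^ r)                                                        ∎
        where
        u = 𝟙 (rank F X ≟ℕ suc r)
        v = 𝟙 (rank F X ≟ℕ r)

  rankCount-> : ∀ d l r → l < r → rankCount d l r ≡ 0
  rankCount-> d zero    (suc r) _         = ≡.refl
  rankCount-> d (suc l) (suc r) (s≤s l<r) = cong₂ (λ u v → u * q ^ suc r + v * (q ^ d ∸ q ^ r))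
    (rankCount-> d l (suc r) (m<n⇒m<1+n l<r)) (rankCount-> d l r l<r)

  -- The number of independent n-tuples in a space with q^s elements, a q-analogue of the falling
  -- factorial. For n > s it is 0 because of the factor with exponent s.
  falling : ℕ → ℕ → ℕ
  falling s zero    = 1
  falling s (suc n) = falling s n * (q ^ s ∸ q ^ n)

  rankCount-full : ∀ d l → rankCount d l l ≡ falling d l
  rankCount-full d zero    = ≡.refl
  rankCount-full d (suc l) = cong₂ (λ u v → u * q ^ suc l + v * (q ^ d ∸ q ^ l))
    (rankCount-> d l (suc l) ≤-refl) (rankCount-full d l)

  -- The joint distribution of rank A and rank A M

  module _ {m} (M : Mat F m m) (k : ℕ) (ker≡ : ker M ≡ q ^ k) where

    -- The recursion for the number of l × m matrices A of rank l such that A M has rank r.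
    jointCount : ℕ → ℕ → ℕ
    jointCount zero    zero    = 1
    jointCount zero    (suc r) = 0
    jointCount (suc l) zero    = jointCount l zero * (q ^ k ∸ q ^ l)
    jointCount (suc l) (suc r) = jointCount l (suc r) * (q ^ (k + suc r) ∸ q ^ l) + jointCount l r * (q ^ m ∸ q ^ (k + r))

    row-matMul : ∀ {l} (A : Mat F l m) {x} → x ∈row A → x · M ∈row matMul F A M
    row-matMul A (γ , e) = γ , V.trans (V.sym (·-assoc γ A M)) (·-congˡ M e)

    ∈row?-resp : ∀ {l} (X : Mat F l m) {x y} → x ≋ y → 𝟙 (x ∈row? X) ≡ 𝟙 (y ∈row? X)
    ∈row?-resp X {x} {y} e = 𝟙-cong (x ∈row? X) (y ∈row? X) (∈row-resp X e) (∈row-resp X (V.sym e))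

    module _ {l} (A : Mat F l m) where
      private
        AM = matMul F A M
        inM : ∀ x → Dec (x · M ∈row AM)
        inM x = x · M ∈row? AM

      -- The row space of A M lies in that of M, so each of its vectors is x M for exactly `ker M`
      -- choices of x.
      count-inM : ∑[ V m ] (λ x → 𝟙 (inM x)) ≡ q ^ (k + rank F AM)
      count-inM = begin
        ∑[ V m ] (λ x → 𝟙 (x · M ∈row? AM))                          ≡⟨ fibre-sum M (λ y → 𝟙 (y ∈row? AM)) (∈row?-resp AM) ⟩
        ker M * ∑[ V m ] (λ y → 𝟙 (y ∈row? M) * 𝟙 (y ∈row? AM))      ≡⟨ cong₂ _*_ ker≡ (∑-cong (V.list {m}) (λ y → ≡.trans (≡.sym (𝟙-× (y ∈row? M) (y ∈row? AM)))
                                                                           (𝟙-cong ((y ∈row? M) ×-dec (y ∈row? AM)) (y ∈row? AM) proj₂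
                                                                             (λ { (γ , e) → (γ · A , V.trans (·-assoc γ A M) e) , (γ , e) })))) ⟩
        q ^ k * rowSize AM                                           ≡⟨ cong (q ^ k *_) (rowSize≡q^rank AM) ⟩
        q ^ k * q ^ rank F AM                                        ≡⟨ ≡.sym (^-distribˡ-+-* q k _) ⟩
        q ^ (k + rank F AM)                                          ∎

      count-inM∖row : ∑[ V m ] (λ x → 𝟙 (¬? (x ∈row? A)) * 𝟙 (inM x)) ≡ q ^ (k + rank F AM) ∸ q ^ rank F A
      count-inM∖row = ≡.trans (count-∖ (V.list {m}) inM (_∈row? A) (λ x → row-matMul A)) (cong₂ _∸_ count-inM (rowSize≡q^rank A))

      -- If x M lies outside the row space of A M, then x lies outside that of A, so the first
      -- condition follows from the second.
      count-∉M : ∑[ V m ] (λ x → 𝟙 (¬? (x ∈row? A)) * 𝟙 (¬? (inM x))) ≡ q ^ m ∸ q ^ (k + rank F AM)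
      count-∉M = begin
        ∑[ V m ] (λ x → 𝟙 (¬? (x ∈row? A)) * 𝟙 (¬? (inM x)))  ≡⟨ ∑-cong (V.list {m}) (λ x → ≡.trans (≡.sym (𝟙-× (¬? (x ∈row? A)) (¬? (inM x))))
                                                                     (≡.trans (𝟙-cong (¬? (x ∈row? A) ×-dec ¬? (inM x)) (¬? (inM x)) proj₂ (λ n → (λ x∈ → n (row-matMul A x∈)) , n))
                                                                       (≡.sym (*-identityʳ _)))) ⟩
        ∑[ V m ] (λ x → 𝟙 (¬? (inM x)) * 1)                   ≡⟨ count-∖ (V.list {m}) (λ _ → yes tt) inM (λ _ _ → tt) ⟩
        ∑[ V m ] (λ _ → 1) ∸ ∑[ V m ] (λ x → 𝟙 (inM x))       ≡⟨ cong₂ _∸_ (|V| m) count-inM ⟩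
        q ^ m ∸ q ^ (k + rank F AM)                           ∎

      private
        full  = 𝟙 (rank F A ≟ℕ l)

        rank-matMul-∷ : ∀ x → rank F (matMul F (x ∷ᶠ A) M) ≡ rank F ((x · M) ∷ᶠ AM)
        rank-matMul-∷ x = rank-cong {X = matMul F (x ∷ᶠ A) M} {(x · M) ∷ᶠ AM} (λ { zero → V.refl ; (suc i) → V.refl })
        -- Under the two indicators the actual ranks of A M and A become the constants r and l.
        pin : ∀ r (f : ℕ → ℕ → ℕ) → full * (𝟙 (rank F AM ≟ℕ r) * f (rank F AM) (rank F A)) ≡ full * 𝟙 (rank F AM ≟ℕ r) * f r l
        pin r f = ≡.trans (cong (full *_) (𝟙≟-* (rank F AM) r (λ s → f s (rank F A))))
          (≡.trans (𝟙≟-* (rank F A) l (λ t → 𝟙 (rank F AM ≟ℕ r) * f r t)) (≡.sym (*-assoc full _ _)))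

      extend-zero : ∑[ V m ] (λ x → 𝟙 (rank F (x ∷ᶠ A) ≟ℕ suc l) * 𝟙 (rank F (matMul F (x ∷ᶠ A) M) ≟ℕ 0)) ≡
        full * 𝟙 (rank F AM ≟ℕ 0) * (q ^ k ∸ q ^ l)
      extend-zero = begin
        ∑[ V m ] (λ x → 𝟙 (rank F (x ∷ᶠ A) ≟ℕ suc l) * 𝟙 (rank F (matMul F (x ∷ᶠ A) M) ≟ℕ 0))
          ≡⟨ ∑-cong (V.list {m}) (λ x → cong₂ _*_ (rank-∷-full x A (x ∈row? A)) (≡.trans (cong (λ s → 𝟙 (s ≟ℕ 0)) (rank-matMul-∷ x)) (rank-∷-zero (x · M) AM (inM x)))) ⟩
        ∑[ V m ] (λ x → full * 𝟙 (¬? (x ∈row? A)) * (𝟙 (inM x) * u))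
          ≡⟨ ∑-cong (V.list {m}) (λ x → regroup full (𝟙 (¬? (x ∈row? A))) (𝟙 (inM x)) u) ⟩
        ∑[ V m ] (λ x → full * u * (𝟙 (¬? (x ∈row? A)) * 𝟙 (inM x)))
          ≡⟨ ∑-*ˡ (V.list {m}) (full * u) _ ⟩
        full * u * ∑[ V m ] (λ x → 𝟙 (¬? (x ∈row? A)) * 𝟙 (inM x))
          ≡⟨ cong (full * u *_) count-inM∖row ⟩
        full * u * (q ^ (k + rank F AM) ∸ q ^ rank F A)
          ≡⟨ ≡.trans (*-assoc full u _) (pin 0 (λ s t → q ^ (k + s) ∸ q ^ t)) ⟩
        full * u * (q ^ (k + 0) ∸ q ^ l)
          ≡⟨ cong (λ z → full * u * (q ^ z ∸ q ^ l)) (+-identityʳ k) ⟩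
        full * u * (q ^ k ∸ q ^ l) ∎
        where
        u = 𝟙 (rank F AM ≟ℕ 0)
        regroup : ∀ w x y z → w * x * (y * z) ≡ w * z * (x * y)
        regroup = solve-∀

      -- A new row x outside the row space of A keeps the rank of A M when x M lies in the row space
      -- of A M, and raises it by one otherwise; these are the two summands.
      extend-suc : ∀ r → ∑[ V m ] (λ x → 𝟙 (rank F (x ∷ᶠ A) ≟ℕ suc l) * 𝟙 (rank F (matMul F (x ∷ᶠ A) M) ≟ℕ suc r)) ≡
        full * 𝟙 (rank F AM ≟ℕ suc r) * (q ^ (k + suc r) ∸ q ^ l) + full * 𝟙 (rank F AM ≟ℕ r) * (q ^ m ∸ q ^ (k + r))
      extend-suc r = begin
        ∑[ V m ] (λ x → 𝟙 (rank F (x ∷ᶠ A) ≟ℕ suc l) * 𝟙 (rank F (matMul F (x ∷ᶠ A) M) ≟ℕ suc r))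
          ≡⟨ ∑-cong (V.list {m}) (λ x → cong₂ _*_ (rank-∷-full x A (x ∈row? A)) (≡.trans (cong (λ s → 𝟙 (s ≟ℕ suc r)) (rank-matMul-∷ x)) (rank-∷-suc (x · M) AM (inM x) r))) ⟩
        ∑[ V m ] (λ x → full * 𝟙 (¬? (x ∈row? A)) * (𝟙 (inM x) * u + 𝟙 (¬? (inM x)) * v))
          ≡⟨ ∑-cong (V.list {m}) (λ x → regroup full (𝟙 (¬? (x ∈row? A))) (𝟙 (inM x)) u (𝟙 (¬? (inM x))) v) ⟩
        ∑[ V m ] (λ x → full * u * (𝟙 (¬? (x ∈row? A)) * 𝟙 (inM x)) + full * v * (𝟙 (¬? (x ∈row? A)) * 𝟙 (¬? (inM x))))
          ≡⟨ ≡.trans (∑-+ (V.list {m}) _ _) (cong₂ _+_ (∑-*ˡ (V.list {m}) (full * u) _) (∑-*ˡ (V.list {m}) (full * v) _)) ⟩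
        full * u * ∑[ V m ] (λ x → 𝟙 (¬? (x ∈row? A)) * 𝟙 (inM x)) + full * v * ∑[ V m ] (λ x → 𝟙 (¬? (x ∈row? A)) * 𝟙 (¬? (inM x)))
          ≡⟨ cong₂ (λ y z → full * u * y + full * v * z) count-inM∖row count-∉M ⟩
        full * u * (q ^ (k + rank F AM) ∸ q ^ rank F A) + full * v * (q ^ m ∸ q ^ (k + rank F AM))
          ≡⟨ cong₂ _+_ (≡.trans (*-assoc full u _) (pin (suc r) (λ s t → q ^ (k + s) ∸ q ^ t)))
                       (≡.trans (*-assoc full v _) (pin r (λ s _ → q ^ m ∸ q ^ (k + s)))) ⟩
        full * u * (q ^ (k + suc r) ∸ q ^ l) + full * v * (q ^ m ∸ q ^ (k + r)) ∎
        where
        u = 𝟙 (rank F AM ≟ℕ suc r)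
        v = 𝟙 (rank F AM ≟ℕ r)
        regroup : ∀ w x y z y′ z′ → w * x * (y * z + y′ * z′) ≡ w * z * (x * y) + w * z′ * (x * y′)
        regroup = solve-∀

    joint : ∀ l r → ∑ (allMats F l m) (λ A → 𝟙 (rank F A ≟ℕ l) * 𝟙 (rank F (matMul F A M) ≟ℕ r)) ≡ jointCount l r
    joint zero r = ≡.trans (+-identityʳ _) (≡.trans
      (cong₂ (λ s t → 𝟙 (s ≟ℕ 0) * 𝟙 (t ≟ℕ r)) (n≤0⇒n≡0 (rank≤rows {b = m} (λ ()))) (n≤0⇒n≡0 (rank≤rows (matMul F {a = 0} (λ ()) M))))
      (empty r))
      where
      empty : ∀ r → 1 * 𝟙 (0 ≟ℕ r) ≡ jointCount zero r
      empty zero    = ≡.refl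
      empty (suc r) = ≡.refl
    joint (suc l) zero = begin
      ∑ (allMats F (suc l) m) (λ A → 𝟙 (rank F A ≟ℕ suc l) * 𝟙 (rank F (matMul F A M) ≟ℕ 0))                ≡⟨ ∑-allMats-suc l m _ ⟩
      ∑ (allMats F l m) _                                                                                  ≡⟨ ∑-cong (allMats F l m) extend-zero ⟩
      ∑ (allMats F l m) (λ A → 𝟙 (rank F A ≟ℕ l) * 𝟙 (rank F (matMul F A M) ≟ℕ 0) * (q ^ k ∸ q ^ l))        ≡⟨ ∑-*ʳ (allMats F l m) (q ^ k ∸ q ^ l) _ ⟩
      ∑ (allMats F l m) (λ A → 𝟙 (rank F A ≟ℕ l) * 𝟙 (rank F (matMul F A M) ≟ℕ 0)) * (q ^ k ∸ q ^ l)        ≡⟨ cong (_* (q ^ k ∸ q ^ l)) (joint l zero) ⟩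
      jointCount (suc l) zero                                                                              ∎
    joint (suc l) (suc r) = begin
      ∑ (allMats F (suc l) m) (λ A → 𝟙 (rank F A ≟ℕ suc l) * 𝟙 (rank F (matMul F A M) ≟ℕ suc r))            ≡⟨ ∑-allMats-suc l m _ ⟩
      ∑ (allMats F l m) _                                                                                  ≡⟨ ∑-cong (allMats F l m) (λ A → extend-suc A r) ⟩
      ∑ (allMats F l m) (λ A → 𝟙 (rank F A ≟ℕ l) * 𝟙 (rank F (matMul F A M) ≟ℕ suc r) * u + 𝟙 (rank F A ≟ℕ l) * 𝟙 (rank F (matMul F A M) ≟ℕ r) * v)
        ≡⟨ ≡.trans (∑-+ (allMats F l m) _ _) (cong₂ _+_ (∑-*ʳ (allMats F l m) u _) (∑-*ʳ (allMats F l m) v _)) ⟩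
      ∑ (allMats F l m) (λ A → 𝟙 (rank F A ≟ℕ l) * 𝟙 (rank F (matMul F A M) ≟ℕ suc r)) * u +
      ∑ (allMats F l m) (λ A → 𝟙 (rank F A ≟ℕ l) * 𝟙 (rank F (matMul F A M) ≟ℕ r)) * v
        ≡⟨ cong₂ (λ y z → y * u + z * v) (joint l (suc r)) (joint l r) ⟩
      jointCount (suc l) (suc r) ∎
      where
      u = q ^ (k + suc r) ∸ q ^ l
      v = q ^ m ∸ q ^ (k + r)

    -- Both coefficients of the recursion factor: q^(k+r+1) - q^l = q^(r+1) (q^k - q^(l-r-1))
    -- supplies the power of q in `rankCount` and the next factor of `falling k`, while q^m -
    -- q^(k+r) = q^k (q^(m-k) - q^r) supplies a factor of `rankCount` and raises q^(k r) to q^(k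
    -- (r+1)).
    jointCount-closed : k ≤ m → ∀ l r → jointCount l r ≡ rankCount (m ∸ k) l r * falling k (l ∸ r) * q ^ (k * r)
    jointCount-closed k≤m zero    zero    = ≡.sym (cong (λ z → 1 * 1 * q ^ z) (*-zeroʳ k))
    jointCount-closed k≤m zero    (suc r) = ≡.refl
    jointCount-closed k≤m (suc l) zero    = begin
      jointCount l 0 * (q ^ k ∸ q ^ l)                                    ≡⟨ cong (_* (q ^ k ∸ q ^ l)) (jointCount-closed k≤m l zero) ⟩
      rankCount d l 0 * falling k l * q ^ (k * 0) * (q ^ k ∸ q ^ l)       ≡⟨ regroup (rankCount d l 0) (falling k l) (q ^ (k * 0)) _ ⟩
      rankCount d l 0 * (falling k l * (q ^ k ∸ q ^ l)) * q ^ (k * 0)     ∎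
      where
      d = m ∸ k
      regroup : ∀ w x y z → w * x * y * z ≡ w * (x * z) * y
      regroup = solve-∀
    jointCount-closed k≤m (suc l) (suc r) = begin
      jointCount l (suc r) * (q ^ (k + suc r) ∸ q ^ l) + jointCount l r * (q ^ m ∸ q ^ (k + r))
        ≡⟨ cong₂ _+_ (≡.trans (cong (_* (q ^ (k + suc r) ∸ q ^ l)) (jointCount-closed k≤m l (suc r))) first)
                     (≡.trans (cong (_* (q ^ m ∸ q ^ (k + r))) (jointCount-closed k≤m l r)) second) ⟩
      rankCount d l (suc r) * q ^ suc r * falling k (l ∸ r) * q ^ (k * suc r) + rankCount d l r * (q ^ d ∸ q ^ r) * falling k (l ∸ r) * q ^ (k * suc r)
        ≡⟨ regroup (rankCount d l (suc r) * q ^ suc r) (rankCount d l r * (q ^ d ∸ q ^ r)) (falling k (l ∸ r)) (q ^ (k * suc r)) ⟩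
      rankCount d (suc l) (suc r) * falling k (l ∸ r) * q ^ (k * suc r) ∎
      where
      d = m ∸ k
      regroup : ∀ w x y z → w * y * z + x * y * z ≡ (w + x) * y * z
      regroup = solve-∀
      first : rankCount d l (suc r) * falling k (l ∸ suc r) * q ^ (k * suc r) * (q ^ (k + suc r) ∸ q ^ l) ≡
              rankCount d l (suc r) * q ^ suc r * falling k (l ∸ r) * q ^ (k * suc r)
      first with suc r ≤? l
      -- For l < r + 1 the exponent l ∸ suc r is truncated, but the count of matrices of rank r + 1
      -- is 0.
      ... | no r≮l rewrite rankCount-> d l (suc r) (≰⇒> r≮l) = ≡.refl
      ... | yes r<l = begin
        N * falling k (l ∸ suc r) * qᵏʳ * (q ^ (k + suc r) ∸ q ^ l)               ≡⟨ cong (N * falling k (l ∸ suc r) * qᵏʳ *_) diff ⟩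
        N * falling k (l ∸ suc r) * qᵏʳ * ((q ^ k ∸ q ^ (l ∸ suc r)) * q ^ suc r) ≡⟨ shuffle N (falling k (l ∸ suc r)) qᵏʳ _ (q ^ suc r) ⟩
        N * q ^ suc r * falling k (suc (l ∸ suc r)) * qᵏʳ                         ≡⟨ cong (λ z → N * q ^ suc r * falling k z * qᵏʳ) (≡.sym (+-∸-assoc 1 r<l)) ⟩
        N * q ^ suc r * falling k (l ∸ r) * qᵏʳ                                   ∎
        where
        N = rankCount d l (suc r)
        qᵏʳ = q ^ (k * suc r)
        shuffle : ∀ v w x y z → v * w * x * (y * z) ≡ v * z * (w * y) * x
        shuffle = solve-∀
        diff : q ^ (k + suc r) ∸ q ^ l ≡ (q ^ k ∸ q ^ (l ∸ suc r)) * q ^ suc r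
        diff = begin
          q ^ (k + suc r) ∸ q ^ l                                 ≡⟨ cong₂ _∸_ (^-distribˡ-+-* q k (suc r)) (≡.trans (cong (q ^_) (≡.sym (m∸n+n≡m r<l))) (^-distribˡ-+-* q (l ∸ suc r) (suc r))) ⟩
          q ^ k * q ^ suc r ∸ q ^ (l ∸ suc r) * q ^ suc r         ≡⟨ ≡.sym (*-distribʳ-∸ (q ^ suc r) (q ^ k) (q ^ (l ∸ suc r))) ⟩
          (q ^ k ∸ q ^ (l ∸ suc r)) * q ^ suc r                   ∎
      second : rankCount d l r * falling k (l ∸ r) * q ^ (k * r) * (q ^ m ∸ q ^ (k + r)) ≡
               rankCount d l r * (q ^ d ∸ q ^ r) * falling k (l ∸ r) * q ^ (k * suc r)
      second = begin
        N * G * q ^ (k * r) * (q ^ m ∸ q ^ (k + r))           ≡⟨ cong (N * G * q ^ (k * r) *_) diff ⟩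
        N * G * q ^ (k * r) * (q ^ k * (q ^ d ∸ q ^ r))       ≡⟨ shuffle N G (q ^ (k * r)) (q ^ k) _ ⟩
        N * (q ^ d ∸ q ^ r) * G * (q ^ k * q ^ (k * r))       ≡⟨ cong (N * (q ^ d ∸ q ^ r) * G *_) (≡.trans (≡.sym (^-distribˡ-+-* q k (k * r))) (cong (q ^_) (≡.sym (*-suc k r)))) ⟩
        N * (q ^ d ∸ q ^ r) * G * q ^ (k * suc r)             ∎
        where
        N = rankCount d l r
        G = falling k (l ∸ r)
        shuffle : ∀ v w x y z → v * w * x * (y * z) ≡ v * z * w * (y * x)
        shuffle = solve-∀
        diff : q ^ m ∸ q ^ (k + r) ≡ q ^ k * (q ^ d ∸ q ^ r)
        diff = begin
          q ^ m ∸ q ^ (k + r)               ≡⟨ cong₂ _∸_ (≡.trans (cong (q ^_) (≡.sym (m+[n∸m]≡n k≤m))) (^-distribˡ-+-* q k d)) (^-distribˡ-+-* q k r) ⟩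
          q ^ k * q ^ d ∸ q ^ k * q ^ r     ≡⟨ ≡.sym (*-distribˡ-∸ (q ^ k) (q ^ d) (q ^ r)) ⟩
          q ^ k * (q ^ d ∸ q ^ r)           ∎

  -- Matrices of full column rank annihilated by a given matrix

  RowsKilledBy : ∀ {n m l} → Mat F m l → Mat F n m → Set ℓ
  RowsKilledBy Z C = ∀ i → C i · Z ≋ 0v

  killed? : ∀ {n m l} (Z : Mat F m l) (C : Mat F n m) → Dec (RowsKilledBy Z C)
  killed? Z C = FinP.all? (λ i → C i · Z ≋? 0v)

  row-killed : ∀ {n m l} (Z : Mat F m l) (C : Mat F n m) → RowsKilledBy Z C → ∀ {x} → x ∈row C → x · Z ≋ 0v
  row-killed {n} Z C kill {x} (γ , e) = V.trans (·-congˡ Z (V.sym e)) (V.trans (·-assoc γ C Z)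
    (λ j → sumF-zero n (λ i → F.trans (F.*-congˡ (kill i j)) (F.zeroʳ (γ i)))))

  -- Each new row is chosen in the kernel of `Z`, of size q^s, and outside the span of the n
  -- independent rows already present, of size q^n, which lies inside that kernel.
  independent-in-kernel : ∀ {m l} (Z : Mat F m l) s → ker Z ≡ q ^ s → ∀ n →
    ∑ (allMats F n m) (λ C → 𝟙 (rank F C ≟ℕ n) * 𝟙 (killed? Z C)) ≡ falling s n
  independent-in-kernel {m} Z s ker≡ zero = ≡.trans (+-identityʳ _)
    (cong₂ _*_ (𝟙-yes (_ ≟ℕ 0) (n≤0⇒n≡0 (rank≤rows {b = m} (λ ())))) (𝟙-yes (killed? {n = 0} Z (λ ())) λ ()))
  independent-in-kernel {m} Z s ker≡ (suc n) = begin
    ∑ (allMats F (suc n) m) (λ C → 𝟙 (rank F C ≟ℕ suc n) * 𝟙 (killed? Z C))              ≡⟨ ∑-allMats-suc n m _ ⟩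
    ∑ (allMats F n m) _                                                                  ≡⟨ ∑-cong (allMats F n m) extend ⟩
    ∑ (allMats F n m) (λ C → 𝟙 (rank F C ≟ℕ n) * 𝟙 (killed? Z C) * (q ^ s ∸ q ^ n))       ≡⟨ ∑-*ʳ (allMats F n m) (q ^ s ∸ q ^ n) _ ⟩
    ∑ (allMats F n m) (λ C → 𝟙 (rank F C ≟ℕ n) * 𝟙 (killed? Z C)) * (q ^ s ∸ q ^ n)       ≡⟨ cong (_* (q ^ s ∸ q ^ n)) (independent-in-kernel Z s ker≡ n) ⟩
    falling s (suc n)                                                                    ∎
    where
    extend : ∀ C → ∑[ V m ] (λ x → 𝟙 (rank F (x ∷ᶠ C) ≟ℕ suc n) * 𝟙 (killed? Z (x ∷ᶠ C))) ≡
      𝟙 (rank F C ≟ℕ n) * 𝟙 (killed? Z C) * (q ^ s ∸ q ^ n)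
    extend C = begin
      ∑[ V m ] (λ x → 𝟙 (rank F (x ∷ᶠ C) ≟ℕ suc n) * 𝟙 (killed? Z (x ∷ᶠ C)))
        ≡⟨ ∑-cong (V.list {m}) (λ x → cong₂ _*_ (rank-∷-full x C (x ∈row? C)) (killed-∷ x)) ⟩
      ∑[ V m ] (λ x → u * 𝟙 (¬? (x ∈row? C)) * (𝟙 (x · Z ≋? 0v) * v))
        ≡⟨ ∑-cong (V.list {m}) (λ x → regroup u (𝟙 (¬? (x ∈row? C))) (𝟙 (x · Z ≋? 0v)) v) ⟩
      ∑[ V m ] (λ x → u * v * (𝟙 (¬? (x ∈row? C)) * 𝟙 (x · Z ≋? 0v)))
        ≡⟨ ∑-*ˡ (V.list {m}) (u * v) _ ⟩
      u * v * ∑[ V m ] (λ x → 𝟙 (¬? (x ∈row? C)) * 𝟙 (x · Z ≋? 0v))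
        ≡⟨ *-assoc u v _ ⟩
      u * (v * ∑[ V m ] (λ x → 𝟙 (¬? (x ∈row? C)) * 𝟙 (x · Z ≋? 0v)))
        -- The span of the rows of C lies in the kernel only when C itself is killed, so the count
        -- is made under the indicator `v`.
        ≡⟨ cong (u *_) (𝟙-*-cong (killed? Z C) (λ kill → ≡.trans
             (count-∖ (V.list {m}) (λ x → x · Z ≋? 0v) (_∈row? C) (λ x → row-killed Z C kill)) (cong₂ _∸_ ker≡ (rowSize≡q^rank C)))) ⟩
      u * (v * (q ^ s ∸ q ^ rank F C))
        ≡⟨ 𝟙≟-* (rank F C) n (λ t → v * (q ^ s ∸ q ^ t)) ⟩
      u * (v * (q ^ s ∸ q ^ n))
        ≡⟨ ≡.sym (*-assoc u v _) ⟩
      u * v * (q ^ s ∸ q ^ n) ∎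
      where
      u = 𝟙 (rank F C ≟ℕ n)
      v = 𝟙 (killed? Z C)
      regroup : ∀ w x y z → w * x * (y * z) ≡ w * z * (x * y)
      regroup = solve-∀
      killed-∷ : ∀ x → 𝟙 (killed? Z (x ∷ᶠ C)) ≡ 𝟙 (x · Z ≋? 0v) * v
      killed-∷ x = ≡.trans
        (𝟙-cong (killed? Z (x ∷ᶠ C)) ((x · Z ≋? 0v) ×-dec killed? Z C)
          (λ h → h zero , h ∘ suc) (λ { (h , t) zero → h ; (h , t) (suc i) → t i }))
        (𝟙-× (x · Z ≋? 0v) (killed? Z C))

  ker-ᵗ≡q^ : ∀ {l m} (Y : Mat F l m) → ker (Y ᵗ) ≡ q ^ (m ∸ rank F Y)
  ker-ᵗ≡q^ {l} {m} Y = *-cancelˡ-≡ _ _ (q ^ rank F Y) {{q^≢0 {rank F Y}}} (begin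
    q ^ rank F Y * ker (Y ᵗ)            ≡⟨ cong (λ r → q ^ r * ker (Y ᵗ)) (≡.sym (rank-ᵗ Y)) ⟩
    q ^ rank F (Y ᵗ) * ker (Y ᵗ)        ≡⟨ rank-ker (Y ᵗ) ⟩
    q ^ m                               ≡⟨ cong (q ^_) (≡.sym (m+[n∸m]≡n (subst (_≤ m) (rank-ᵗ Y) (rank≤rows (Y ᵗ))))) ⟩
    q ^ (rank F Y + (m ∸ rank F Y))     ≡⟨ ^-distribˡ-+-* q (rank F Y) _ ⟩
    q ^ rank F Y * q ^ (m ∸ rank F Y)   ∎)

  -- Y B = 0 says that the rows of the transpose of B lie in the left kernel of the transpose of Y.
  -- Transposition preserves rank, so full column rank of B becomes independence of these rows.
  annihilated-columns : ∀ {l m} (Y : Mat F l m) n →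
    ∑ (allMats F m n) (λ B → 𝟙 (rank F B ≟ℕ n) * 𝟙 (killed? (Y ᵗ) (B ᵗ))) ≡ falling (m ∸ rank F Y) n
  annihilated-columns {l} {m} Y n = ≡.trans
    (∑-reindex (matrices m n) (matrices n m) _ᵗ _ᵗ (λ e j i → e i j) (λ e j i → e i j) (λ X i j → F.refl) (λ X i j → F.refl)
      (λ B → 𝟙 (rank F B ≟ℕ n) * 𝟙 (killed? (Y ᵗ) (B ᵗ))) resp)
    (≡.trans (∑-cong (allMats F n m) (λ C → cong (λ r → 𝟙 (r ≟ℕ n) * 𝟙 (killed? (Y ᵗ) C)) (rank-ᵗ C)))
      (independent-in-kernel (Y ᵗ) (m ∸ rank F Y) (ker-ᵗ≡q^ Y) n))
    where
    resp : ∀ {B C : Mat F m n} → (∀ i → B i ≋ C i) →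
      𝟙 (rank F B ≟ℕ n) * 𝟙 (killed? (Y ᵗ) (B ᵗ)) ≡ 𝟙 (rank F C ≟ℕ n) * 𝟙 (killed? (Y ᵗ) (C ᵗ))
    resp {B} {C} e = cong₂ _*_ (cong (λ r → 𝟙 (r ≟ℕ n)) (rank-cong {X = B} {C} e))
      (𝟙-cong (killed? (Y ᵗ) (B ᵗ)) (killed? (Y ᵗ) (C ᵗ))
        (λ k i → V.trans (·-congˡ (Y ᵗ) (λ j → F.sym (e j i))) (k i))
        (λ k i → V.trans (·-congˡ (Y ᵗ) (λ j → e j i)) (k i)))

  -- Full column rank is meant, so this is the preceding count for a matrix `O` without rows, which
  -- imposes no condition on B.
  cardMats-full : ∀ m n → cardMatsOfRank F m n n ≡ falling m n
  cardMats-full m n = ≡.trans (cardMatsOfRank≡∑ m n n) (≡.trans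
    (∑-cong (allMats F m n) (λ B → ≡.sym (≡.trans (cong (𝟙 (rank F B ≟ℕ n) *_) (𝟙-yes (killed? (O ᵗ) (B ᵗ)) (λ i ()))) (*-identityʳ _))))
    (≡.trans (annihilated-columns O n) (cong (λ r → falling (m ∸ r) n) (n≤0⇒n≡0 (rank≤rows O)))))
    where
    O : Mat F 0 m
    O ()

-- Permutations, their orbits and cycle representatives

Inj : ∀ {m} → (Fin m → Fin m) → Set
Inj π = ∀ {i j} → π i ≡ π j → i ≡ j

T-isPerm : ∀ {m} (π : Fin m → Fin m) → T (isPerm π) ⇔ Inj π
T-isPerm {m} π = mk⇔
  (λ t {i} {j} e → pick (to T-∨ (to (T-allFinᵇ m _) (to (T-allFinᵇ m _) t i) j)) e)
  (λ inj → from (T-allFinᵇ m _) (λ i → from (T-allFinᵇ m _) (λ j → build inj i j)))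
  where
  pick : ∀ {i j} → T (not (π i ==Fin π j)) ⊎ T (i ==Fin j) → π i ≡ π j → i ≡ j
  pick {i} {j} (inj₁ n) e = ⊥-elim (to T-not n (from (T-isYes (π i Fin.≟ π j)) e))
  pick {i} {j} (inj₂ t) e = to (T-isYes (i Fin.≟ j)) t
  build : Inj π → ∀ i j → T (not (π i ==Fin π j) ∨ (i ==Fin j))
  build inj i j with T? (π i ==Fin π j)
  ... | no n  = from (T-∨ {not (π i ==Fin π j)}) (inj₁ (from T-not n))
  ... | yes t = from (T-∨ {not (π i ==Fin π j)}) (inj₂ (from (T-isYes (i Fin.≟ j)) (inj (to (T-isYes (π i Fin.≟ π j)) t))))

endos : ℕ → Enumeration _ _
endos m = functions (fin m) m

isPerm-cong : ∀ {m} {π σ : Fin m → Fin m} → (Inj π → Inj σ) → (Inj σ → Inj π) → ⟦ isPerm π ⟧ ≡ ⟦ isPerm σ ⟧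
isPerm-cong {π = π} {σ} f g = 𝟙-cong (T? (isPerm π)) (T? (isPerm σ))
  (λ t → from (T-isPerm σ) (f (to (T-isPerm π) t))) (λ t → from (T-isPerm π) (g (to (T-isPerm σ) t)))

∑-Sym : ∀ m f → ∑ (Sym m) f ≡ ∑[ endos m ] (λ π → ⟦ isPerm π ⟧ * f π)
∑-Sym m f = ∑-filter isPerm (allFuns (allFin m) m) f

∑-Sym-cong : ∀ m {f g : (Fin m → Fin m) → ℕ} → (∀ π → Inj π → f π ≡ g π) → ∑ (Sym m) f ≡ ∑ (Sym m) g
∑-Sym-cong m {f} {g} e = ≡.trans (∑-Sym m f) (≡.trans
  (∑-cong (allFuns (allFin m) m) (λ π → 𝟙-*-cong (T? (isPerm π)) (λ t → e π (to (T-isPerm π) t))))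
  (≡.sym (∑-Sym m g)))

iter-+ : ∀ {m} s t (π : Fin m → Fin m) i → iter (s + t) π i ≡ iter s π (iter t π i)
iter-+ zero    t π i = ≡.refl
iter-+ (suc s) t π i = cong π (iter-+ s t π i)

isLeast : ∀ {m} → (Fin m → Fin m) → Fin m → Bool
isLeast {m} π i = allᵇ (λ t → toℕ i ≤ᵇ toℕ (iter t π i)) (upTo m)

module Orbits {m} (π : Fin m → Fin m) (inj : Inj π) where

  iter-injective : ∀ t {i j} → iter t π i ≡ iter t π j → i ≡ j
  iter-injective zero    e = e
  iter-injective (suc t) e = iter-injective t (inj e)

  -- Among m + 1 iterates two coincide, and cancelling the earlier one leaves a positive period of
  -- at most m. Written as `suc p`, it gives the preimage of `i` as the p-th iterate and serves as a
  -- nonzero modulus.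
  period : ∀ i → ∃ λ p → suc p ≤ m × iter (suc p) π i ≡ i
  period i with FinP.pigeonhole ≤-refl (λ (t : Fin (suc m)) → iter (toℕ t) π i)
  ... | s , t , s<t , e = toℕ t ∸ suc (toℕ s) , bound , ≡.sym (iter-injective (toℕ s) returns)
    where
    gap : toℕ s + suc (toℕ t ∸ suc (toℕ s)) ≡ toℕ t
    gap = ≡.trans (+-suc (toℕ s) _) (m+[n∸m]≡n s<t)
    bound : suc (toℕ t ∸ suc (toℕ s)) ≤ m
    bound = ≤-trans (m≤n+m _ (toℕ s)) (≤-trans (≤-reflexive gap) (FinP.toℕ≤pred[n] t))
    returns : iter (toℕ s) π i ≡ iter (toℕ s) π (iter (suc (toℕ t ∸ suc (toℕ s))) π i)
    returns = ≡.trans e (≡.trans (cong (λ u → iter u π i) (≡.sym gap)) (iter-+ (toℕ s) _ π i))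

  _⁻¹ : Fin m → Fin m
  i ⁻¹ = iter (proj₁ (period i)) π i

  inverseʳ : ∀ i → π (i ⁻¹) ≡ i
  inverseʳ i = proj₂ (proj₂ (period i))

  inverseˡ : ∀ i → (π i) ⁻¹ ≡ i
  inverseˡ i = inj (inverseʳ (π i))

  infix 4 _⟿_
  _⟿_ : Fin m → Fin m → Set
  i ⟿ j = ∃ λ t → iter t π i ≡ j

  ⟿-trans : ∀ {i j k} → i ⟿ j → j ⟿ k → i ⟿ k
  ⟿-trans {i} (s , e) (t , e′) = t + s , ≡.trans (iter-+ t s π i) (≡.trans (cong (iter t π) e) e′)

  iter-multiple : ∀ t p {i} → iter p π i ≡ i → iter (t * p) π i ≡ i
  iter-multiple zero    p e = ≡.refl
  iter-multiple (suc t) p {i} e = ≡.trans (iter-+ p (t * p) π i) (≡.trans (cong (iter p π) (iter-multiple t p e)) e)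

  ⟿-sym : ∀ {i j} → i ⟿ j → j ⟿ i
  -- After t steps, p * t more make (p + 1) * t, a multiple of the period.
  ⟿-sym {i} (t , ≡.refl) = p * t , ≡.trans (≡.sym (iter-+ (p * t) t π i))
    (≡.trans (cong (λ u → iter u π i) (≡.trans (+-comm (p * t) t) (*-comm (suc p) t))) (iter-multiple t (suc p) (proj₂ (proj₂ (period i)))))
    where p = proj₁ (period i)

  -- Reducing the exponent modulo the period brings it below m, the range over which `numCycles`
  -- tests minimality.
  ⟿-bounded : ∀ {i j} → i ⟿ j → ∃ λ t → t < m × iter t π i ≡ j
  ⟿-bounded {i} (t , e) = t % suc p , ≤-trans (m%n<n t (suc p)) (proj₁ (proj₂ (period i))) , ≡.trans (≡.sym reduce) e
    where
    p = proj₁ (period i)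
    reduce : iter t π i ≡ iter (t % suc p) π i
    reduce = ≡.trans (cong (λ u → iter u π i) (m≡m%n+[m/n]*n t (suc p)))
      (≡.trans (iter-+ (t % suc p) _ π i) (cong (iter (t % suc p) π) (iter-multiple (t / suc p) (suc p) (proj₂ (proj₂ (period i))))))

  orbit : Fin m → List (Fin m)
  orbit i = map (λ t → iter t π i) (upTo m)

  -- The default value `i` of `argmin` lies in the orbit itself, so it cannot spoil the minimum.
  root : Fin m → Fin m
  root i = argmin toℕ i (orbit i)

  root-reached : ∀ i → i ⟿ root i
  root-reached i with argmin-sel toℕ i (orbit i)
  ... | inj₁ e  = 0 , ≡.sym e
  ... | inj₂ r∈ = let t , _ , e = ∈-map⁻ (λ t → iter t π i) r∈ in t , ≡.sym e

  root-least : ∀ {i j} → i ⟿ j → toℕ (root i) ≤ toℕ j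
  root-least {i} r with ⟿-bounded r
  ... | t , t<m , ≡.refl = All.lookup (f[argmin]≤f[xs] {f = toℕ} i (orbit i)) (∈-map⁺ (λ t → iter t π i) (∈-upTo⁺ t<m))

  root-cong : ∀ {i j} → i ⟿ j → root i ≡ root j
  root-cong {i} {j} r = FinP.toℕ-injective (≤-antisym
    (root-least (⟿-trans r (root-reached j)))
    (root-least (⟿-trans (⟿-sym r) (root-reached i))))

  isLeast-root : ∀ i → T (isLeast π (root i))
  isLeast-root i = from (T-allᵇ _ (upTo m)) (All.universal
    (λ t → ≤⇒≤ᵇ (root-least (⟿-trans (root-reached i) (t , ≡.refl)))) (upTo m))

  isLeast⇒root : ∀ i → T (isLeast π i) → root i ≡ i
  isLeast⇒root i t with ⟿-bounded (root-reached i)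
  ... | s , s<m , e = FinP.toℕ-injective (≤-antisym (root-least (0 , ≡.refl))
    (≤-trans (≤ᵇ⇒≤ _ _ (All.lookup (to (T-allᵇ _ (upTo m)) t) (∈-upTo⁺ s<m))) (≤-reflexive (cong toℕ e))))

-- Right translation by ρ permutes all self-maps up to pointwise equality and preserves injectivity
-- in both directions. Since π ∘ ρ⁻¹ ∘ ρ agrees with π only pointwise, `h` must respect such
-- agreement.
∑-Sym-translate : ∀ m (ρ : Fin m → Fin m) → Inj ρ → (h : (Fin m → Fin m) → ℕ) →
  (∀ {π σ} → π ≗ σ → h π ≡ h σ) → ∑ (Sym m) h ≡ ∑ (Sym m) (λ σ → h (σ ∘ ρ))
∑-Sym-translate m ρ ρ-inj h h-cong = ≡.trans (∑-Sym m h) (≡.trans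
  (∑-reindex (endos m) (endos m) (λ π → π ∘ _⁻¹) (λ σ → σ ∘ ρ)
    (λ e i → e (i ⁻¹)) (λ e i → e (ρ i))
    (λ π i → cong π (inverseˡ i)) (λ σ i → cong σ (inverseʳ i))
    (λ π → ⟦ isPerm π ⟧ * h π)
    (λ {π} {σ} e → cong₂ _*_ (isPerm-cong {π = π} {σ} (λ inj e′ → inj (≡.trans (e _) (≡.trans e′ (≡.sym (e _)))))
                                     (λ inj e′ → inj (≡.trans (≡.sym (e _)) (≡.trans e′ (e _))))) (h-cong e)))
  (≡.trans (∑-cong (allFuns (allFin m) m) (λ σ → cong (_* h (σ ∘ ρ))
      (isPerm-cong {π = σ ∘ ρ} {σ} (λ inj {i} {j} e → ≡.trans (≡.sym (inverseʳ i)) (≡.trans (cong ρ (inj (≡.trans (cong σ (inverseʳ i)) (≡.trans e (≡.sym (cong σ (inverseʳ j))))))) (inverseʳ j)))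
                   (λ inj e → ρ-inj (inj e)))))
    (≡.sym (∑-Sym m (λ σ → h (σ ∘ ρ))))))
  where open Orbits ρ ρ-inj

numCycles≥1 : ∀ {m} (π : Fin m → Fin m) → 1 ≤ m → 1 ≤ numCycles π
numCycles≥1 {suc m} π _ = ≤-trans (≤-reflexive (≡.sym (𝟙-yes (T? (isLeast π zero)) 0-least)))
  (≤-trans (m≤m+n _ _) (≤-reflexive (≡.sym (length-filter (isLeast π) (allFin (suc m))))))
  where
  0-least : T (isLeast π zero)
  0-least = from (T-allᵇ (λ t → 0 ≤ᵇ toℕ (iter t π zero)) (upTo (suc m))) (All.universal (λ t → _) (upTo (suc m)))

numCycles≤ : ∀ {m} (π : Fin m → Fin m) → numCycles π ≤ m
numCycles≤ {m} π = ≤-trans (Data.List.Properties.length-filter _ (allFin m)) (≤-reflexive (Data.List.Properties.length-tabulate id))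

1≤∣Sym∣ : ∀ m → 1 ≤ length (Sym m)
1≤∣Sym∣ m = ≤-trans (≤-reflexive (≡.sym (Enumeration.once (endos m) id)))
  (≤-trans (∑-mono (allFuns (allFin m) m) (λ π → 𝟙-mono (Enumeration._≟_ (endos m) id π) (T? (isPerm π))
      (λ e → from (T-isPerm π) (λ e′ → ≡.trans (e _) (≡.trans e′ (≡.sym (e _)))))))
    (≤-reflexive (≡.sym (length-filter isPerm (allFuns (allFin m) m)))))

∑-applyUpTo : ∀ {a} {A : Set a} n (g : ℕ → A) (f : A → ℕ) → ∑ (applyUpTo g n) f ≡ ∑ (upTo n) (f ∘ g)
∑-applyUpTo zero    g f = ≡.refl
∑-applyUpTo (suc n) g f = cong (f (g 0) +_) (≡.trans (∑-applyUpTo n (g ∘ suc) f) (≡.sym (∑-applyUpTo n suc (f ∘ g))))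

∑-upTo-δ : ∀ n x (h : ℕ → ℕ) → x < n → ∑ (upTo n) (λ r → 𝟙 (x Data.Nat.≟ r) * h r) ≡ h x
∑-upTo-δ (suc n) zero    h _         = ≡.trans (cong₂ _+_ (*-identityˡ (h 0))
  (≡.trans (∑-applyUpTo n suc _) (∑-zero (upTo n)))) (+-identityʳ (h 0))
∑-upTo-δ (suc n) (suc x) h (s≤s x<n) = ≡.trans (∑-applyUpTo n suc _) (∑-upTo-δ n x (h ∘ suc) x<n)

-- The kernel of a difference of two permutation matrices

module Permuted {c ℓ} (F : FiniteField c ℓ) where
  private module F = FiniteField F
  open F using (_≈_; 0#; 1#; elements) renaming (_+_ to _⊕_; _*_ to _⊗_; -_ to ⊖_)
  open LinearAlgebra F
  open Rank F
  open Counting F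
  open Recursions F
  open V using () renaming (_≈_ to _≋_; _≟_ to _≋?_)
  open ≡.≡-Reasoning

  permMat-on : ∀ {m} (π : Fin m → Fin m) i → permMat F π i (π i) ≈ 1#
  permMat-on π i with π i Fin.≟ π i
  ... | yes _ = F.refl
  ... | no ne = ⊥-elim (ne ≡.refl)

  permMat-off : ∀ {m} (π : Fin m → Fin m) i j → ¬ (π i ≡ j) → permMat F π i j ≈ 0#
  permMat-off π i j ne with π i Fin.≟ j
  ... | yes e = ⊥-elim (ne e)
  ... | no _  = F.refl

  -- Row i of the permutation matrix has its 1 in column π i, so a i moves to position π i; by
  -- injectivity no other entry arrives there.
  ·-permMat : ∀ {m} (π : Fin m → Fin m) → Inj π → ∀ (a : Vec m) i → (a · permMat F π) (π i) ≈ a i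
  ·-permMat {m} π inj a i = F.trans
    (sumF-single m i (λ k i≢k → F.trans (F.*-congˡ (permMat-off π k (π i) (λ e → i≢k (≡.sym (inj e))))) (F.zeroʳ (a k))))
    (F.trans (F.*-congˡ (permMat-on π i)) (F.*-identityʳ (a i)))

  ·-permMat-at : ∀ {m} (π : Fin m → Fin m) → Inj π → ∀ (a : Vec m) {i j} → π i ≡ j → (a · permMat F π) j ≈ a i
  ·-permMat-at π inj a {i} ≡.refl = ·-permMat π inj a i

  _−_ : ∀ {a b} → Mat F a b → Mat F a b → Mat F a b
  (X − Y) i = X i ⊟ Y i

  ·-− : ∀ {a b} (γ : Vec a) (X Y : Mat F a b) → γ · (X − Y) ≋ γ · X ⊟ γ · Y
  ·-− {a} γ X Y j = +≈⇒≈- (F.trans (F.sym (sumF-⊕ (λ i → γ i ⊗ (X i j ⊕ ⊖ Y i j)) (λ i → γ i ⊗ Y i j)))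
    (sumF-cong a (λ i → F.trans (F.sym (F.distribˡ (γ i) _ (Y i j))) (F.*-congˡ (x-y+y (X i j) (Y i j))))))

  matEq-⇔ : ∀ {a b} (X Y : Mat F a b) → T (matEq F X Y) ⇔ (∀ i → X i ≋ Y i)
  matEq-⇔ {a} {b} X Y = mk⇔
    (λ t i j → to (T-isYes (X i j F.≈? Y i j)) (to (T-allFinᵇ b _) (to (T-allFinᵇ a _) t i) j))
    (λ e → from (T-allFinᵇ a _) (λ i → from (T-allFinᵇ b _) (λ j → from (T-isYes (X i j F.≈? Y i j)) (e i j))))

  module _ {m} (ρ σ : Fin m → Fin m) (ρ-inj : Inj ρ) (σ-inj : Inj σ) where
    private
      module ρ = Orbits ρ ρ-inj
    open Orbits σ σ-inj

    permDiff : Mat F m m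
    permDiff = permMat F ρ − permMat F (σ ∘ ρ)

    -- Entry σ i of a · `permDiff` is a (ρ⁻¹ (σ i)) - a (ρ⁻¹ i). The inverse of ρ relabels `a` so
    -- that the cycles of σ, rather than those of a conjugate, describe the kernel.
    Invariant : Vec m → Set ℓ
    Invariant a = ∀ i → a (σ i ρ.⁻¹) ≈ a (i ρ.⁻¹)

    killed⇒invariant : ∀ a → a · permDiff ≋ 0v → Invariant a
    killed⇒invariant a e i = F.trans (F.sym (·-permMat-at ρ ρ-inj a (ρ.inverseʳ (σ i))))
      (F.trans (-≈0⇒≈ (F.trans (F.sym (·-− a (permMat F ρ) (permMat F (σ ∘ ρ)) (σ i))) (e (σ i))))
        (·-permMat-at (σ ∘ ρ) (λ e′ → ρ-inj (σ-inj e′)) a (cong σ (ρ.inverseʳ i))))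

    invariant⇒killed : ∀ a → Invariant a → a · permDiff ≋ 0v
    invariant⇒killed a inv j = F.trans (·-− a (permMat F ρ) (permMat F (σ ∘ ρ)) j) (≈⇒-≈0 (F.trans
      (·-permMat-at ρ ρ-inj a (≡.trans (ρ.inverseʳ (σ (j ⁻¹))) (inverseʳ j)))
      (F.trans (inv (j ⁻¹)) (F.sym (·-permMat-at (σ ∘ ρ) (λ e′ → ρ-inj (σ-inj e′)) a (≡.trans (cong σ (ρ.inverseʳ (j ⁻¹))) (inverseʳ j)))))))

    invariant-⟿ : ∀ a → Invariant a → ∀ {i j} → i ⟿ j → a (j ρ.⁻¹) ≈ a (i ρ.⁻¹)
    invariant-⟿ a inv (t , ≡.refl) = along t
      where
      along : ∀ t {i} → a (iter t σ i ρ.⁻¹) ≈ a (i ρ.⁻¹)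
      along zero    = F.refl
      along (suc t) = F.trans (inv _) (along t)

    -- A vector killed by the difference is determined by its values at the least elements of the cycles of σ.
    ker-permDiff : ker permDiff ≡ q ^ numCycles σ
    ker-permDiff = ≡.trans
      (count-bijection (V m) (V m) (λ a → a · permDiff ≋? 0v) (supported? (isLeast σ))
        (λ e → V.trans (·-congˡ permDiff (V.sym e)))
        (λ e s i → Data.Sum.map₂ (F.trans (F.sym (e i))) (s i))
        restrict spread restrict-cong (λ e i → e (root (ρ i)))
        (λ {a} _ → restrict-supported a)
        (λ {b} _ → invariant⇒killed (spread b) (spread-invariant b))
        (λ {a} e i → F.trans (restrict-on a (isLeast-root (ρ i)))
          (F.trans (invariant-⟿ a (killed⇒invariant a e) (root-reached (ρ i))) (F.reflexive (cong a (ρ.inverseˡ i)))))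
        (λ {b} s → restrict-spread b s))
      (count-supported (isLeast σ))
      where
      restrict : Vec m → Vec m
      restrict a i = if isLeast σ i then a (i ρ.⁻¹) else 0#
      spread : Vec m → Vec m
      spread b i = b (root (ρ i))
      restrict-on : ∀ a {i} → T (isLeast σ i) → restrict a i ≈ a (i ρ.⁻¹)
      restrict-on a {i} t with isLeast σ i
      ... | true = F.refl
      restrict-cong : ∀ {a b} → a ≋ b → restrict a ≋ restrict b
      restrict-cong e i with isLeast σ i
      ... | true  = e (i ρ.⁻¹)
      ... | false = F.refl
      restrict-supported : ∀ a → Supported (isLeast σ) (restrict a)
      restrict-supported a i with isLeast σ i
      ... | true  = inj₁ _
      ... | false = inj₂ F.refl
      spread-invariant : ∀ b → Invariant (spread b)
      spread-invariant b i = F.reflexive (cong b (≡.trans (cong root (ρ.inverseʳ (σ i)))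
        (≡.trans (≡.sym (root-cong (1 , ≡.refl))) (cong root (≡.sym (ρ.inverseʳ i))))))
      restrict-spread : ∀ b → Supported (isLeast σ) b → restrict (spread b) ≋ b
      restrict-spread b s i with isLeast σ i | s i | isLeast⇒root i
      ... | true  | _      | r = F.reflexive (cong b (≡.trans (cong root (ρ.inverseʳ i)) (r _)))
      ... | false | inj₂ z | _ = F.sym z

    -- By bilinearity the difference of the two products is A M B with M = `permDiff`; it vanishes
    -- when each column of B is orthogonal to every row of A M.
    matEq-killed : ∀ {l n} (A : Mat F l m) (B : Mat F m n) →
      ⟦ matEq F (matMul F (matMul F A (permMat F ρ)) B) (matMul F (matMul F A (permMat F (σ ∘ ρ))) B) ⟧ ≡
      𝟙 (killed? (matMul F A permDiff ᵗ) (B ᵗ))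
    matEq-killed A B = 𝟙-cong (T? (matEq F R S)) (killed? (Y ᵗ) (B ᵗ))
      (λ t j i → F.trans (adjoint i j) (≈⇒-≈0 (to (matEq-⇔ R S) t i j)))
      (λ e → from (matEq-⇔ R S) (λ i j → -≈0⇒≈ (F.trans (F.sym (adjoint i j)) (e j i))))
      where
      Π  = permMat F ρ
      Π′ = permMat F (σ ∘ ρ)
      R  = matMul F (matMul F A Π) B
      S  = matMul F (matMul F A Π′) B
      Y  = matMul F A permDiff
      adjoint : ∀ i j → ((B ᵗ) j · Y ᵗ) i ≈ R i j ⊕ ⊖ S i j
      adjoint i j = F.trans (sumF-cong m (λ k → F.*-comm (B k j) (Y i k)))
        (F.trans (·-congˡ B (·-− (A i) Π Π′) j) (·-⊟ (A i · Π) (A i · Π′) B j))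

-- Double counting of all solutions

∑-swap₄ : ∀ {a b c d} {A : Set a} {B : Set b} {C : Set c} {D : Set d} as bs cs ds (f : A → B → C → D → ℕ) →
  ∑ as (λ w → ∑ bs (λ x → ∑ cs (λ y → ∑ ds (f w x y)))) ≡ ∑ ds (λ z → ∑ cs (λ y → ∑ as (λ w → ∑ bs (λ x → f w x y z))))
∑-swap₄ as bs cs ds f = begin
  ∑ as (λ w → ∑ bs (λ x → ∑ cs (λ y → ∑ ds (f w x y))))                        ≡⟨ ∑-cong as (λ w → ∑-cong bs (λ x → ∑-swap cs ds (f w x))) ⟩
  ∑ as (λ w → ∑ bs (λ x → ∑ ds (λ z → ∑ cs (λ y → f w x y z))))                ≡⟨ rotate ds (λ w x z → ∑ cs (λ y → f w x y z)) ⟩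
  ∑ ds (λ z → ∑ as (λ w → ∑ bs (λ x → ∑ cs (λ y → f w x y z))))                ≡⟨ ∑-cong ds (λ z → rotate cs (λ w x y → f w x y z)) ⟩
  ∑ ds (λ z → ∑ cs (λ y → ∑ as (λ w → ∑ bs (λ x → f w x y z))))                ∎
  where
  open ≡.≡-Reasoning
  rotate : ∀ {e} {E : Set e} (es : List E) g → ∑ as (λ w → ∑ bs (λ x → ∑ es (g w x))) ≡ ∑ es (λ z → ∑ as (λ w → ∑ bs (λ x → g w x z)))
  rotate es g = ≡.trans (∑-cong as (λ w → ∑-swap bs es (g w))) (∑-swap as es (λ w z → ∑ bs (λ x → g w x z)))

module Solutions {c ℓ} (F : FiniteField c ℓ) where
  private module F = FiniteField F
  open F using (0#; 1#)
  open LinearAlgebra F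
  open Rank F
  open Counting F
  open Recursions F
  open Permuted F
  open V using () renaming (_≈_ to _≋_; _≟_ to _≋?_)
  open ≡.≡-Reasoning

  ∑-MatsOfRank : ∀ a b r (f : Mat F a b → ℕ) →
    ∑ (MatsOfRank F a b r) f ≡ ∑ (allMats F a b) (λ X → 𝟙 (rank F X ≟ℕ r) * f X)
  ∑-MatsOfRank a b r f = ≡.trans (∑-filter _ (allMats F a b) f)
    (∑-cong (allMats F a b) (λ X → cong (_* f X) (isYes≡𝟙 (rank F X ≟ℕ r))))

  rank-of-ker : ∀ {a b} (X : Mat F a b) k → ker X ≡ q ^ k → rank F X ≡ a ∸ k
  rank-of-ker {a} X k ker≡ = ≡.trans (≡.sym (m+n∸n≡m (rank F X) k)) (cong (_∸ k) (q^-injective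
    (≡.trans (^-distribˡ-+-* q (rank F X) k) (≡.trans (cong (q ^ rank F X *_) (≡.sym ker≡)) (rank-ker X)))))

  rank-matMul-≤ : ∀ {a b d} (A : Mat F a b) (M : Mat F b d) → rank F (matMul F A M) ≤ rank F M
  rank-matMul-≤ {d = d} A M = q^-cancel-≤ (≡.subst₂ _≤_ (rowSize≡q^rank (matMul F A M)) (rowSize≡q^rank M)
    (∑-mono (V.list {d}) (λ x → 𝟙-mono (x ∈row? matMul F A M) (x ∈row? M)
      (λ (γ , e) → γ · A , V.trans (·-assoc γ A M) e))))

  -- The inner sum of the formula with its denominators cleared. It will count the pairs (A , B) of
  -- full rank with A M B = 0, for one M whose left kernel has q^k elements.
  perClass : ℕ → ℕ → ℕ → ℕ → ℕ
  perClass l m n k = ∑ (upTo (suc (l ⊓ (m ∸ k)))) (λ r →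
    cardMatsOfRank F l (m ∸ k) r * cardMatsOfRank F (l ∸ r) k (l ∸ r) * q ^ (k * r) * falling (m ∸ r) n)

  module _ {m} (M : Mat F m m) (k : ℕ) (k≤m : k ≤ m) (ker≡ : ker M ≡ q ^ k) (l n : ℕ) where

    ∑-by-joint-rank : ∑ (allMats F l m) (λ A → 𝟙 (rank F A ≟ℕ l) * falling (m ∸ rank F (matMul F A M)) n) ≡ perClass l m n k
    ∑-by-joint-rank = begin
      ∑ (allMats F l m) (λ A → 𝟙 (rank F A ≟ℕ l) * falling (m ∸ rank F (matMul F A M)) n)
        -- The range of r misses no value: rank (A M) is at most the number l of rows and at most
        -- rank M = m ∸ k.
        ≡⟨ ∑-cong (allMats F l m) (λ A → cong (𝟙 (rank F A ≟ℕ l) *_) (≡.sym (∑-upTo-δ (suc (l ⊓ (m ∸ k))) _ (λ r → falling (m ∸ r) n) (s≤s (bound A))))) ⟩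
      ∑ (allMats F l m) (λ A → 𝟙 (rank F A ≟ℕ l) * ∑ rs (λ r → 𝟙 (rank F (matMul F A M) ≟ℕ r) * falling (m ∸ r) n))
        ≡⟨ ∑-cong (allMats F l m) (λ A → ≡.trans (≡.sym (∑-*ˡ rs (𝟙 (rank F A ≟ℕ l)) _)) (∑-cong rs (λ r → ≡.sym (*-assoc (𝟙 (rank F A ≟ℕ l)) _ _)))) ⟩
      ∑ (allMats F l m) (λ A → ∑ rs (λ r → 𝟙 (rank F A ≟ℕ l) * 𝟙 (rank F (matMul F A M) ≟ℕ r) * falling (m ∸ r) n))
        ≡⟨ ∑-swap (allMats F l m) rs _ ⟩
      ∑ rs (λ r → ∑ (allMats F l m) (λ A → 𝟙 (rank F A ≟ℕ l) * 𝟙 (rank F (matMul F A M) ≟ℕ r) * falling (m ∸ r) n))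
        ≡⟨ ∑-cong rs (λ r → ∑-*ʳ (allMats F l m) (falling (m ∸ r) n) _) ⟩
      ∑ rs (λ r → ∑ (allMats F l m) (λ A → 𝟙 (rank F A ≟ℕ l) * 𝟙 (rank F (matMul F A M) ≟ℕ r)) * falling (m ∸ r) n)
        ≡⟨ ∑-cong rs (λ r → cong (_* falling (m ∸ r) n) (≡.trans (joint M k ker≡ l r) (≡.trans (jointCount-closed M k ker≡ k≤m l r) (≡.sym (counts r))))) ⟩
      perClass l m n k ∎
      where
      rs = upTo (suc (l ⊓ (m ∸ k)))
      bound : ∀ A → rank F (matMul F A M) ≤ l ⊓ (m ∸ k)
      bound A = ⊓-glb (rank≤rows (matMul F A M)) (≤-trans (rank-matMul-≤ A M) (≤-reflexive (rank-of-ker M k ker≡)))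
      counts : ∀ r → cardMatsOfRank F l (m ∸ k) r * cardMatsOfRank F (l ∸ r) k (l ∸ r) * q ^ (k * r) ≡
                     rankCount (m ∸ k) l r * falling k (l ∸ r) * q ^ (k * r)
      counts r = cong₂ (λ u v → u * v * q ^ (k * r)) (cardMatsOfRank≡rankCount l (m ∸ k) r)
        (≡.trans (cardMatsOfRank≡rankCount (l ∸ r) k (l ∸ r)) (rankCount-full k (l ∸ r)))

  module _ (l m n : ℕ) where

    agree : (π ρ : Fin m → Fin m) (A : Mat F l m) (B : Mat F m n) → ℕ
    agree π ρ A B = ⟦ matEq F (matMul F (matMul F A (permMat F ρ)) B) (matMul F (matMul F A (permMat F π)) B) ⟧

    pairs : (π ρ : Fin m → Fin m) → ℕ
    pairs π ρ = ∑ (MatsOfRank F l m l) (λ A → ∑ (MatsOfRank F m n n) (λ B → agree π ρ A B))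

    -- With π = σ ∘ ρ the count retains only the number of cycles of σ, so the later sum over ρ
    -- merely multiplies by `length (Sym m)`.
    pairs-∘ : ∀ ρ σ → Inj ρ → Inj σ → pairs (σ ∘ ρ) ρ ≡ perClass l m n (numCycles σ)
    pairs-∘ ρ σ ρ-inj σ-inj = begin
      pairs (σ ∘ ρ) ρ
        ≡⟨ ∑-MatsOfRank l m l _ ⟩
      ∑ (allMats F l m) (λ A → 𝟙 (rank F A ≟ℕ l) * ∑ (MatsOfRank F m n n) (λ B → agree (σ ∘ ρ) ρ A B))
        ≡⟨ ∑-cong (allMats F l m) (λ A → cong (𝟙 (rank F A ≟ℕ l) *_) (inner A)) ⟩
      ∑ (allMats F l m) (λ A → 𝟙 (rank F A ≟ℕ l) * falling (m ∸ rank F (matMul F A D)) n)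
        ≡⟨ ∑-by-joint-rank D (numCycles σ) (numCycles≤ σ) (ker-permDiff ρ σ ρ-inj σ-inj) l n ⟩
      perClass l m n (numCycles σ) ∎
      where
      D = permDiff ρ σ ρ-inj σ-inj
      inner : ∀ A → ∑ (MatsOfRank F m n n) (λ B → agree (σ ∘ ρ) ρ A B) ≡ falling (m ∸ rank F (matMul F A D)) n
      inner A = ≡.trans (∑-MatsOfRank m n n _)
        (≡.trans (∑-cong (allMats F m n) (λ B → cong (𝟙 (rank F B ≟ℕ n) *_) (matEq-killed ρ σ ρ-inj σ-inj A B)))
          (annihilated-columns (matMul F A D) n))

    pairs-cong : ∀ ρ {π σ} → π ≗ σ → pairs π ρ ≡ pairs σ ρ
    pairs-cong ρ {π} {σ} e = ∑-cong (MatsOfRank F l m l) (λ A → ∑-cong (MatsOfRank F m n n) (λ B → same A B))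
      where
      same : ∀ A B → agree π ρ A B ≡ agree σ ρ A B
      same A B = 𝟙-cong (T? (matEq F R (S π))) (T? (matEq F R (S σ)))
        (λ t → from (matEq-⇔ R (S σ)) (λ i → V.trans (to (matEq-⇔ R (S π)) t i) (S-cong e i)))
        (λ t → from (matEq-⇔ R (S π)) (λ i → V.trans (to (matEq-⇔ R (S σ)) t i) (S-cong (λ i → ≡.sym (e i)) i)))
        where
        R = matMul F (matMul F A (permMat F ρ)) B
        S : (Fin m → Fin m) → Mat F l n
        S π = matMul F (matMul F A (permMat F π)) B
        S-cong : ∀ {π σ} → π ≗ σ → ∀ i → S π i ≋ S σ i
        S-cong {π} {σ} e i = ·-congˡ B (·-cong {X = permMat F π} {permMat F σ} V.refl
          (λ k j → F.reflexive (cong (λ x → if x ==Fin j then 1# else 0#) (e k))))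

    totalSolutions : ℕ
    totalSolutions = sum (concatMap (λ A → concatMap (λ B → map (λ π →
      Nsol F A B (matMul F (matMul F A (permMat F π)) B)) (Sym m)) (MatsOfRank F m n n)) (MatsOfRank F l m l))

    cyclesSum : ℕ
    cyclesSum = ∑ (map suc (upTo m)) (λ k → cardSmk m k * perClass l m n k)

    -- A permutation of a nonempty set has between 1 and m cycles, so the classes k = 1, ..., m
    -- exhaust `Sym m`.
    ∑-numCycles : 1 ≤ m → (h : ℕ → ℕ) → ∑ (Sym m) (h ∘ numCycles) ≡ ∑ (map suc (upTo m)) (λ k → cardSmk m k * h k)
    ∑-numCycles 1≤m h = begin
      ∑ (Sym m) (h ∘ numCycles)                                                            ≡⟨ ∑-cong (Sym m) (λ σ → split σ (numCycles σ) (numCycles≥1 σ 1≤m) (numCycles≤ σ)) ⟩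
      ∑ (Sym m) (λ σ → ∑ (upTo m) (λ k → 𝟙 (numCycles σ ≟ℕ suc k) * h (suc k)))            ≡⟨ ∑-swap (Sym m) (upTo m) _ ⟩
      ∑ (upTo m) (λ k → ∑ (Sym m) (λ σ → 𝟙 (numCycles σ ≟ℕ suc k) * h (suc k)))            ≡⟨ ∑-cong (upTo m) (λ k → ∑-*ʳ (Sym m) (h (suc k)) _) ⟩
      ∑ (upTo m) (λ k → ∑ (Sym m) (λ σ → 𝟙 (numCycles σ ≟ℕ suc k)) * h (suc k))            ≡⟨ ∑-cong (upTo m) (λ k → cong (_* h (suc k)) (≡.sym (class k))) ⟩
      ∑ (upTo m) (λ k → cardSmk m (suc k) * h (suc k))                                     ≡⟨ ≡.sym (∑-map suc (upTo m) _) ⟩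
      ∑ (map suc (upTo m)) (λ k → cardSmk m k * h k)                                       ∎
      where
      split : ∀ (σ : Fin m → Fin m) c → 1 ≤ c → c ≤ m → h c ≡ ∑ (upTo m) (λ k → 𝟙 (c ≟ℕ suc k) * h (suc k))
      split σ (suc c) _ c<m = ≡.sym (∑-upTo-δ m c (h ∘ suc) c<m)
      class : ∀ k → cardSmk m (suc k) ≡ ∑ (Sym m) (λ σ → 𝟙 (numCycles σ ≟ℕ suc k))
      class k = ≡.trans (length-filter _ (Sym m)) (∑-cong (Sym m) (λ σ → isYes≡𝟙 (numCycles σ ≟ℕ suc k)))

    totalSolutions≡ : 1 ≤ m → totalSolutions ≡ length (Sym m) * cyclesSum
    totalSolutions≡ 1≤m = begin
      totalSolutions
        ≡⟨ sum≡∑ (concatMap _ (MatsOfRank F l m l)) ⟩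
      ∑ (concatMap _ (MatsOfRank F l m l)) id
        ≡⟨ ≡.trans (∑-concatMap _ (MatsOfRank F l m l) id) (∑-cong (MatsOfRank F l m l) (λ A →
             ≡.trans (∑-concatMap _ (MatsOfRank F m n n) id) (∑-cong (MatsOfRank F m n n) (λ B →
             ≡.trans (∑-map _ (Sym m) id) (∑-cong (Sym m) (λ π → length-filter _ (Sym m))))))) ⟩
      ∑ (MatsOfRank F l m l) (λ A → ∑ (MatsOfRank F m n n) (λ B → ∑ (Sym m) (λ π → ∑ (Sym m) (λ ρ → agree π ρ A B))))
        -- Both permutations are moved outside the matrices, so that π can be replaced by σ ∘ ρ
        -- before pairs (A , B) are counted.
        ≡⟨ ∑-swap₄ (MatsOfRank F l m l) (MatsOfRank F m n n) (Sym m) (Sym m) (λ A B π ρ → agree π ρ A B) ⟩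
      ∑ (Sym m) (λ ρ → ∑ (Sym m) (λ π → pairs π ρ))
        ≡⟨ ∑-Sym-cong m (λ ρ ρ-inj → ≡.trans (∑-Sym-translate m ρ ρ-inj (λ π → pairs π ρ) (pairs-cong ρ))
             (∑-Sym-cong m (λ σ σ-inj → pairs-∘ ρ σ ρ-inj σ-inj))) ⟩
      ∑ (Sym m) (λ ρ → ∑ (Sym m) (perClass l m n ∘ numCycles))
        ≡⟨ ∑-cong (Sym m) (λ ρ → ≡.trans (∑-numCycles 1≤m (perClass l m n)) (≡.sym (*-identityˡ cyclesSum))) ⟩
      ∑ (Sym m) (λ ρ → 1 * cyclesSum)
        ≡⟨ ≡.trans (∑-*ʳ (Sym m) cyclesSum (λ _ → 1)) (cong (_* cyclesSum) (∑-one (Sym m))) ⟩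
      length (Sym m) * cyclesSum ∎

-- Arithmetic of fractions

open ℤ using (+_)

-- Reduction to lowest terms hides the given numerator and denominator; in the unnormalised
-- rationals they stay visible, and equality is cross multiplication.
divℤ≃ : ∀ z d → ℚ.toℚᵘ (divℤ z (suc d)) ℚᵘ.≃ ℚᵘ.mkℚᵘ z d
divℤ≃ z d = ℚP.toℚᵘ-fromℚᵘ (ℚᵘ.mkℚᵘ z d)

divℤ-* : ∀ y z d e .{{_ : NonZero d}} .{{_ : NonZero e}} → divℤ y d ℚ.* divℤ z e ≡ divℤ (y ℤ.* z) (d * e)
divℤ-* y z (suc d) (suc e) = ℚP.toℚᵘ-injective (begin
  ℚ.toℚᵘ (divℤ y (suc d) ℚ.* divℤ z (suc e))               ≈⟨ ℚP.toℚᵘ-homo-* (divℤ y (suc d)) (divℤ z (suc e)) ⟩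
  ℚ.toℚᵘ (divℤ y (suc d)) ℚᵘ.* ℚ.toℚᵘ (divℤ z (suc e))     ≈⟨ ℚᵘP.*-cong (divℤ≃ y d) (divℤ≃ z e) ⟩
  -- Denominators are stored minus one: `suc d * suc e` is `suc (e + d * suc e)`.
  ℚᵘ.mkℚᵘ (y ℤ.* z) (e + d * suc e)                        ≈⟨ ℚᵘP.≃-sym (divℤ≃ (y ℤ.* z) (e + d * suc e)) ⟩
  ℚ.toℚᵘ (divℤ (y ℤ.* z) (suc d * suc e))                  ∎)
  where open SetoidReasoning ℚᵘP.≃-setoid

divℤ-+ : ∀ y z d .{{_ : NonZero d}} → divℤ y d ℚ.+ divℤ z d ≡ divℤ (y ℤ.+ z) d
divℤ-+ y z (suc d) = ℚP.toℚᵘ-injective (begin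
  ℚ.toℚᵘ (divℤ y (suc d) ℚ.+ divℤ z (suc d))               ≈⟨ ℚP.toℚᵘ-homo-+ (divℤ y (suc d)) (divℤ z (suc d)) ⟩
  ℚ.toℚᵘ (divℤ y (suc d)) ℚᵘ.+ ℚ.toℚᵘ (divℤ z (suc d))     ≈⟨ ℚᵘP.+-cong (divℤ≃ y d) (divℤ≃ z d) ⟩
  ℚᵘ.mkℚᵘ y d ℚᵘ.+ ℚᵘ.mkℚᵘ z d                             ≈⟨ ℚᵘ.*≡* common ⟩
  ℚᵘ.mkℚᵘ (y ℤ.+ z) d                                      ≈⟨ ℚᵘP.≃-sym (divℤ≃ (y ℤ.+ z) d) ⟩
  ℚ.toℚᵘ (divℤ (y ℤ.+ z) (suc d))                          ∎)
  where
  open SetoidReasoning ℚᵘP.≃-setoid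
  common : (y ℤ.* + suc d ℤ.+ z ℤ.* + suc d) ℤ.* + suc d ≡ (y ℤ.+ z) ℤ.* + (suc d * suc d)
  common = ≡.trans (cong (ℤ._* + suc d) (≡.sym (ℤP.*-distribʳ-+ (+ suc d) y z)))
    (≡.trans (ℤP.*-assoc (y ℤ.+ z) (+ suc d) (+ suc d)) (cong ((y ℤ.+ z) ℤ.*_) (≡.sym (ℤP.pos-* (suc d) (suc d)))))

divℤ-cancelˡ : ∀ s n d .{{_ : NonZero s}} .{{_ : NonZero d}} → divℤ (+ (s * n)) (s * d) ≡ divℤ (+ n) d
divℤ-cancelˡ (suc s) n (suc d) = ℚP.fromℚᵘ-cong {ℚᵘ.mkℚᵘ (+ (suc s * n)) _} {ℚᵘ.mkℚᵘ (+ n) d} (ℚᵘ.*≡* (begin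
  + (suc s * n) ℤ.* + suc d      ≡⟨ ≡.sym (ℤP.pos-* (suc s * n) (suc d)) ⟩
  + (suc s * n * suc d)          ≡⟨ cong +_ (shuffle (suc s) n (suc d)) ⟩
  + (n * (suc s * suc d))        ≡⟨ ℤP.pos-* n (suc s * suc d) ⟩
  + n ℤ.* + (suc s * suc d)      ∎))
  where
  open ≡.≡-Reasoning
  shuffle : ∀ x y z → x * y * z ≡ y * (x * z)
  shuffle = solve-∀

divℤ-zero : ∀ d → divℤ (+ 0) d ≡ ℚ.0ℚ
divℤ-zero zero    = ≡.refl
divℤ-zero (suc d) = ℚP.toℚᵘ-injective (ℚᵘP.≃-trans (divℤ≃ (+ 0) d) (ℚᵘ.*≡* ≡.refl))

sumℚ-divℤ : ∀ {a} {A : Set a} (xs : List A) (f : A → ℚ) (g : A → ℕ) d .{{_ : NonZero d}} →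
  (∀ x → f x ≡ divℤ (+ g x) d) → sumℚ (map f xs) ≡ divℤ (+ ∑ xs g) d
sumℚ-divℤ []       f g d e = ≡.sym (divℤ-zero d)
sumℚ-divℤ (x ∷ xs) f g d e = ≡.trans (cong₂ ℚ._+_ (e x) (sumℚ-divℤ xs f g d e)) (divℤ-+ (+ g x) (+ ∑ xs g) d)

-- `prodℚ` peels off the first factor, whereas `falling` grows by its last one; the last factor is
-- split off to match.
prodℚ-upTo-suc : ∀ (f : ℕ → ℚ) n → prodℚ (map f (upTo (suc n))) ≡ prodℚ (map f (upTo n)) ℚ.* f n
prodℚ-upTo-suc f n = ≡.trans (cong prodℚ (≡.trans (cong (map f) (≡.sym (Data.List.Properties.upTo-∷ʳ n)))
  (Data.List.Properties.map-++ f (upTo n) (n ∷ [])))) (snoc (map f (upTo n)))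
  where
  snoc : ∀ xs → prodℚ (xs ++ f n ∷ []) ≡ prodℚ xs ℚ.* f n
  snoc []       = ≡.trans (ℚP.*-identityʳ (f n)) (≡.sym (ℚP.*-identityˡ (f n)))
  snoc (x ∷ xs) = ≡.trans (cong (x ℚ.*_) (snoc xs)) (≡.sym (ℚP.*-assoc x (prodℚ xs) (f n)))

-- Both sides of the theorem over a common denominator

module Expectation {c ℓ} (F : FiniteField c ℓ) where
  open LinearAlgebra F using (q; 1<q)
  open Rank F using (q≢0)
  open Recursions F
  open Solutions F
  open ≡.≡-Reasoning

  falling-> : ∀ s n → s < n → falling s n ≡ 0
  falling-> s (suc n) (s≤s s≤n) with m≤n⇒m<n∨m≡n s≤n
  ... | inj₁ s<n    = cong (_* (q ^ s ∸ q ^ n)) (falling-> s n s<n)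
  ... | inj₂ ≡.refl = ≡.trans (cong (falling s n *_) (n∸n≡0 (q ^ s))) (*-zeroʳ (falling s n))

  falling≢0 : ∀ s n → n ≤ s → NonZero (falling s n)
  falling≢0 s zero    _   = _
  falling≢0 s (suc n) n<s = m*n≢0 (falling s n) _ {{falling≢0 s n (<⇒≤ n<s)}} {{>-nonZero (m<n⇒0<n∸m (^-monoʳ-< q 1<q n<s))}}

  -- When n > s both sides vanish, so truncated and integer subtraction agree on the whole product.
  +falling-suc : ∀ s n → + falling s n ℤ.* (+ (q ^ s) ℤ.- + (q ^ n)) ≡ + falling s (suc n)
  +falling-suc s n with n ≤? s
  ... | yes n≤s = ≡.trans (cong (+ falling s n ℤ.*_) (≡.trans (ℤP.m-n≡m⊖n (q ^ s) (q ^ n)) (ℤP.⊖-≥ (^-monoʳ-≤ q n≤s))))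
                    (≡.sym (ℤP.pos-* (falling s n) _))
  ... | no n≰s  = ≡.trans (cong (λ x → + x ℤ.* (+ (q ^ s) ℤ.- + (q ^ n))) (falling-> s n (≰⇒> n≰s)))
                    (≡.sym (cong +_ (falling-> s (suc n) (m<n⇒m<1+n (≰⇒> n≰s)))))

  -- The bound n ≤ m makes every denominator positive, so the zero convention of `divℤ` never
  -- applies. In use s is m ∸ r, which may be smaller than n.
  prodℚ-falling : ∀ s m n → n ≤ m →
    prodℚ (map (λ i → divℤ (+ (q ^ s) ℤ.- + (q ^ i)) (q ^ m ∸ q ^ i)) (upTo n)) ≡ divℤ (+ falling s n) (falling m n)
  prodℚ-falling s m zero    _   = ≡.refl
  prodℚ-falling s m (suc n) n<m = begin
    prodℚ (map f (upTo (suc n)))                                                                     ≡⟨ prodℚ-upTo-suc f n ⟩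
    prodℚ (map f (upTo n)) ℚ.* f n                                                                   ≡⟨ cong (ℚ._* f n) (prodℚ-falling s m n (<⇒≤ n<m)) ⟩
    divℤ (+ falling s n) (falling m n) ℚ.* f n                                                       ≡⟨ divℤ-* _ _ (falling m n) (q ^ m ∸ q ^ n) {{falling≢0 m n (<⇒≤ n<m)}} {{>-nonZero (m<n⇒0<n∸m (^-monoʳ-< q 1<q n<m))}} ⟩
    divℤ (+ falling s n ℤ.* (+ (q ^ s) ℤ.- + (q ^ n))) (falling m (suc n))                           ≡⟨ cong (λ z → divℤ z (falling m (suc n))) (+falling-suc s n) ⟩
    divℤ (+ falling s (suc n)) (falling m (suc n))                                                   ∎
    where
    f : ℕ → ℚ
    f i = divℤ (+ (q ^ s) ℤ.- + (q ^ i)) (q ^ m ∸ q ^ i)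

  module _ (l m n : ℕ) (1≤m : 1 ≤ m) (l≤m : l ≤ m) (n≤m : n ≤ m) where
    private
      NA = cardMatsOfRank F l m l
      NB = cardMatsOfRank F m n n
      NS = length (Sym m)
      instance
        NA≢0 : NonZero NA
        NA≢0 = subst NonZero (≡.sym (≡.trans (cardMatsOfRank≡rankCount l m l) (rankCount-full m l))) (falling≢0 m l l≤m)
        falling-n≢0 : NonZero (falling m n)
        falling-n≢0 = falling≢0 m n n≤m
        NS≢0 : NonZero NS
        NS≢0 = >-nonZero (1≤∣Sym∣ m)
        D≢0 : NonZero (NA * falling m n)
        D≢0 = m*n≢0 NA (falling m n)

    expectedNsol≡ : expectedNsol F l m n ≡ divℤ (+ cyclesSum l m n) (NA * falling m n)
    expectedNsol≡ = begin
      divℤ (+ totalSolutions l m n) (NA * NB * NS)                  ≡⟨ cong₂ (λ x y → divℤ (+ x) (NA * y * NS)) (totalSolutions≡ l m n 1≤m) (cardMats-full m n) ⟩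
      divℤ (+ (NS * cyclesSum l m n)) (NA * falling m n * NS)       ≡⟨ cong (divℤ (+ (NS * cyclesSum l m n))) (*-comm (NA * falling m n) NS) ⟩
      -- The factor `NS` from the sum over ρ cancels the one from the uniform choice of π.
      divℤ (+ (NS * cyclesSum l m n)) (NS * (NA * falling m n))     ≡⟨ divℤ-cancelˡ NS (cyclesSum l m n) (NA * falling m n) ⟩
      divℤ (+ cyclesSum l m n) (NA * falling m n)                   ∎

    formulaRHS≡ : formulaRHS F l m n ≡ divℤ (+ cyclesSum l m n) (NA * falling m n)
    formulaRHS≡ = sumℚ-divℤ (map suc (upTo m)) _ (λ k → cardSmk m k * perClass l m n k) (NA * falling m n) (λ k → begin
      -- By computation `divℤ` with denominator 1 is the integer as it appears in `formulaRHS`.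
      divℤ (+ cardSmk m k) 1 ℚ.* sumℚ (map (summand k) (upTo (suc (l ⊓ (m ∸ k)))))
        ≡⟨ cong (divℤ (+ cardSmk m k) 1 ℚ.*_) (sumℚ-divℤ (upTo (suc (l ⊓ (m ∸ k)))) (summand k) _ (NA * falling m n) (term k)) ⟩
      divℤ (+ cardSmk m k) 1 ℚ.* divℤ (+ perClass l m n k) (NA * falling m n)
        ≡⟨ divℤ-* (+ cardSmk m k) (+ perClass l m n k) 1 (NA * falling m n) ⟩
      divℤ (+ cardSmk m k ℤ.* + perClass l m n k) (1 * (NA * falling m n))
        ≡⟨ cong₂ divℤ (≡.sym (ℤP.pos-* (cardSmk m k) (perClass l m n k))) (*-identityˡ (NA * falling m n)) ⟩
      divℤ (+ (cardSmk m k * perClass l m n k)) (NA * falling m n) ∎)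
      where
      weight : ℕ → ℕ → ℕ
      weight k r = cardMatsOfRank F l (m ∸ k) r * cardMatsOfRank F (l ∸ r) k (l ∸ r) * q ^ (k * r)
      summand : ℕ → ℕ → ℚ
      summand k r = divℤ (+ weight k r) NA ℚ.* prodℚ (map (λ i → divℤ (+ (q ^ (m ∸ r)) ℤ.- + (q ^ i)) (q ^ m ∸ q ^ i)) (upTo n))
      term : ∀ k r → summand k r ≡ divℤ (+ (weight k r * falling (m ∸ r) n)) (NA * falling m n)
      term k r = begin
        summand k r                                                   ≡⟨ cong (divℤ (+ N) NA ℚ.*_) (prodℚ-falling (m ∸ r) m n n≤m) ⟩
        divℤ (+ N) NA ℚ.* divℤ (+ falling (m ∸ r) n) (falling m n)    ≡⟨ divℤ-* (+ N) (+ falling (m ∸ r) n) NA (falling m n) ⟩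
        divℤ (+ N ℤ.* + falling (m ∸ r) n) (NA * falling m n)         ≡⟨ cong (λ z → divℤ z (NA * falling m n)) (≡.sym (ℤP.pos-* N (falling (m ∸ r) n))) ⟩
        divℤ (+ (N * falling (m ∸ r) n)) (NA * falling m n)           ∎
        where
        N = weight k r

theorem1 : ∀ {c ℓ} (F : FiniteField c ℓ) (l m n : ℕ) →
    1 ≤ l → 1 ≤ m → 1 ≤ n → l ⊔ n ≤ m →
    expectedNsol F l m n ≡ formulaRHS F l m n
theorem1 F l m n _ 1≤m _ l⊔n≤m = ≡.trans (expectedNsol≡ l m n 1≤m l≤m n≤m) (≡.sym (formulaRHS≡ l m n 1≤m l≤m n≤m))
  where
  open Expectation F
  l≤m = m⊔n≤o⇒m≤o l n l⊔n≤m
  n≤m = m⊔n≤o⇒n≤o l n l⊔n≤m
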